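{- Let $N,M\ge 1$ be integers and let $S$ be a 2-string with $|S|=2N$. Then the rational function $F_S(x_1,\dots,x_N;\bm{z})$ is symmetric in $(x_1,\dots,x_N)$, and the rational function $G_S(y_1,\dots,y_M;\bm{z})$ is symmetric in $(y_1,\dots,y_M)$.
   Context: **Weights.** All parameters ($q$ and the spectral parameters) are generic/indeterminates; all identities are between rational functions. For $i,j,k,\ell\in\{0,1,2\}$ the Izergin--Korepin vertex weight $W_{y/x}(i,j;k,\ell)$ ($i$ = bottom incoming state, $j$ = left incoming state, $k$ = top outgoing state, $\ell$ = right outgoing state; $x$ = parameter of the horizontal line, $y$ = parameter of the vertical line) depends on $x,y$ only through $y/x$, and, with $D=(x-q^2y)(x-q^3y)$, is given by $W(0,0;0,0)=W(2,2;2,2)=1$; $W(1,0;1,0)=W(2,1;2,1)=\frac{q^2(x-y)}{x-q^2y}$; $W(1,0;0,1)=W(2,1;1,2)=\frac{(1-q^2)x}{x-q^2y}$; $W(0,1;1,0)=W(1,2;2,1)=\frac{(1-q^2)y}{x-q^2y}$; $W(0,1;0,1)=W(1,2;1,2)=\frac{x-y}{x-q^2y}$; $W(2,0;2,0)=\frac{q^4(x-y)(x-qy)}{D}$; $W(2,0;1,1)=-\frac{q(1-q)^2(1+q)x(x-y)}{D}$; $W(2,0;0,2)=\frac{(1-q^2)x(x+qx-qy-q^3y)}{D}$; $W(1,1;2,0)=-\frac{q^4(1+q)(x-y)y}{D}$; $W(1,1;1,1)=\frac{ -qx^2+(1+q)(1-q^2+q^4)xy-q^4y^2}{D}$; $W(1,1;0,2)=\frac{(1+q)x(x-y)}{D}$;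 $W(0,2;2,0)=\frac{(1-q^2)(x+q^2x-q^2y-q^3y)y}{D}$; $W(0,2;1,1)=\frac{q(1-q)^2(1+q)(x-y)y}{D}$; $W(0,2;0,2)=\frac{(x-y)(x-qy)}{D}$; and $W=0$ in all other cases. **2-strings.** A 2-string is an infinite vector $S=(S_1,S_2,\dots)$ with $S_i\in\{0,1,2\}$ and only finitely many nonzero entries; $|S|=\sum_i S_i$. Trailing zeros may be dropped. $\bm{z}=(z_1,z_2,\dots)$ is an infinite alphabet. **$F_S$.** Let $|S|=2N$ and choose $L$ with $S_c=0$ for $c>L$. Then $$F_S(x_1,\dots,x_N;\bm{z})=\sum\prod_{r=1}^{N}\prod_{c=1}^{L}W_{z_c/x_r}(v_{r-1,c},h_{r,c-1};v_{r,c},h_{r,c}),$$ summed over all $h_{r,c}\in\{0,1,2\}$ ($1\le r\le N$, $0\le c\le L$) and $v_{r,c}\in\{0,1,2\}$ ($0\le r\le N$, $1\le c\le L$) with $h_{r,0}=2$, $h_{r,L}=0$, $v_{0,c}=0$, $v_{N,c}=S_c$. (Independent of the choice of $L$.) **$G_S$.** Let $|S|=2N$ and choose $L\ge N$ with $S_c=0$ for $c>L$. Then $$G_S(y_1,\dots,y_M;\bm{z})=\sum\prod_{r=1}^{M}\prod_{c=1}^{L}W_{z_c/y_r}(v_{r-1,c},h_{r,c-1};v_{r,c},h_{r,c}),$$ summed over all $h_{r,c},v_{r,c}\in\{0,1,2\}$ with $h_{r,0}=h_{r,L}=0$, $v_{0,c}=2$ for $c\le N$, $v_{0,c}=0$ for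 $c>N$, and $v_{M,c}=S_c$. (Independent of $L$.) -}

module Defs where

open import Algebra.Apartness.Bundles using (HeytingCommutativeRing; HeytingField)
open import Algebra.Bundles using (CommutativeRing)
import Algebra.Properties.CommutativeMonoid.Sum as Sum
import Algebra.Properties.Semiring.Exp as Exp
open import Data.Bool.Base using (if_then_else_)
open import Data.Fin.Base using (Fin; zero; suc; toℕ; fromℕ; inject₁)
open import Data.Fin.Patterns using (0F; 1F; 2F)
open import Data.Fin.Permutation using (Permutation′; _⟨$⟩ʳ_)
import Data.Fin.Properties as Fin
open import Data.List.Base using (List; []; _∷_; [_]; map; foldr; filter; upTo; allFin; cartesianProduct; cartesianProductWith)
open import Data.Nat.Base using (ℕ; zero; suc; _≤_; _<ᵇ_)
open import Data.Nat.ListAction using (sum)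
open import Data.Product.Base using (_×_; _,_; proj₁)
open import Data.Vec.Base using (Vec; []; _∷_; lookup)
open import Function.Base using (_∘_)
open import Level using (_⊔_)
open import Relation.Binary.PropositionalEquality using (_≡_)
open import Relation.Nullary.Decidable using (Dec; _×-dec_)

State : Set
State = Fin 3

-- Entries are indexed from 0: `entry c` is S_{c+1}, and likewise `z c` is
-- z_{c+1} for the alphabets below.
record TwoString : Set where
  field
    entry    : ℕ → State
    bound    : ℕ
    finitary : ∀ c → bound ≤ c → entry c ≡ 0F

open TwoString public

VanishesFrom : ℕ → TwoString → Set
VanishesFrom L S = ∀ c → L ≤ c → entry S c ≡ 0F

∣_∣ : TwoString → ℕ
∣ S ∣ = sum (map (toℕ ∘ entry S) (upTo (bound S)))

allVecs : ∀ {A : Set} → List A → ∀ n → List (Vec A n)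
allVecs xs zero    = [ [] ]
allVecs xs (suc n) = cartesianProductWith _∷_ xs (allVecs xs n)

-- A pair (h , v) of labellings of all edges of an n × L grid.  Row 0 is the
-- bottom row and column 0 the leftmost one; `h` has L + 1 horizontal edges in
-- every row and `v` has n + 1 layers of vertical edges.
Config : ℕ → ℕ → Set
Config n L = Vec (Vec State (suc L)) n × Vec (Vec State L) (suc n)

allConfigs : ∀ n L → List (Config n L)
allConfigs n L = cartesianProduct
  (allVecs (allVecs (allFin 3) (suc L)) n)
  (allVecs (allVecs (allFin 3) L) (suc n))

hor : ∀ {n L} → Config n L → Fin n → Fin (suc L) → State
hor (h , _) r c = lookup (lookup h r) c

ver : ∀ {n L} → Config n L → Fin (suc n) → Fin L → State
ver (_ , v) r c = lookup (lookup v r) c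

record Boundary (L : ℕ) : Set where
  field
    left right  : State
    bottom top  : Fin L → State

Obeys : ∀ {n L} → Boundary L → Config n L → Set
Obeys {n} {L} b κ =
    (∀ r → hor κ r zero ≡ left)
  × (∀ r → hor κ r (fromℕ L) ≡ right)
  × (∀ c → ver κ zero c ≡ bottom c)
  × (∀ c → ver κ (fromℕ n) c ≡ top c)
  where open Boundary b

obeys? : ∀ {n L} (b : Boundary L) (κ : Config n L) → Dec (Obeys b κ)
obeys? {n} {L} b κ =
        Fin.all? (λ r → hor κ r zero Fin.≟ left)
  ×-dec Fin.all? (λ r → hor κ r (fromℕ L) Fin.≟ right)
  ×-dec Fin.all? (λ c → ver κ zero c Fin.≟ bottom c)
  ×-dec Fin.all? (λ c → ver κ (fromℕ n) c Fin.≟ top c)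
  where open Boundary b

boundaryF : (S : TwoString) (L : ℕ) → Boundary L
boundaryF S L = record
  { left   = 2F
  ; right  = 0F
  ; bottom = λ _ → 0F
  ; top    = entry S ∘ toℕ
  }

boundaryG : (N : ℕ) (S : TwoString) (L : ℕ) → Boundary L
boundaryG N S L = record
  { left   = 0F
  ; right  = 0F
  ; bottom = λ c → if toℕ c <ᵇ N then 2F else 0F
  ; top    = entry S ∘ toℕ
  }

-- A rational function is represented by its values at all points, over an
-- arbitrary field, at which the denominators of the vertex weights do not
-- vanish.  Taking K to be a field of rational functions in which q, the row
-- parameters and the z's are indeterminates gives identities of rational
-- functions in the literal sense.
module IzerginKorepin {k ℓ₁ ℓ₂} (K : HeytingField k ℓ₁ ℓ₂)
                      (q : HeytingField.Carrier K) where

  open HeytingField K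
  open CommutativeRing (HeytingCommutativeRing.commutativeRing heytingCommutativeRing)
    using (semiring; *-commutativeMonoid)
  open Exp semiring using (_^_)
  open Sum *-commutativeMonoid using () renaming (sum to ∏)

  inverse : ∀ {a b} → a # b → Carrier
  inverse a#b = proj₁ (#⇒invertible a#b)

  -- `inverse` of the two components is 1 / (x - q²y) and 1 / (x - q³y).
  Regular : (y x : Carrier) → Set ℓ₂
  Regular y x = x # q ^ 2 * y × x # q ^ 3 * y

  -- W y x _ i j k ℓ is W_{y/x}(i, j; k, ℓ): bottom, left, top, right.
  W : ∀ y x → Regular y x → (i j k ℓ : State) → Carrier
  W y x (p , p′) = weight
    where
    d⁻¹ D⁻¹ : Carrier
    d⁻¹ = inverse p
    D⁻¹ = inverse p * inverse p′

    weight : (i j k ℓ : State) → Carrier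
    weight 0F 0F 0F 0F = 1#
    weight 2F 2F 2F 2F = 1#
    weight 1F 0F 1F 0F = q ^ 2 * (x - y) * d⁻¹
    weight 2F 1F 2F 1F = q ^ 2 * (x - y) * d⁻¹
    weight 1F 0F 0F 1F = (1# - q ^ 2) * x * d⁻¹
    weight 2F 1F 1F 2F = (1# - q ^ 2) * x * d⁻¹
    weight 0F 1F 1F 0F = (1# - q ^ 2) * y * d⁻¹
    weight 1F 2F 2F 1F = (1# - q ^ 2) * y * d⁻¹
    weight 0F 1F 0F 1F = (x - y) * d⁻¹
    weight 1F 2F 1F 2F = (x - y) * d⁻¹
    weight 2F 0F 2F 0F = q ^ 4 * (x - y) * (x - q * y) * D⁻¹
    weight 2F 0F 1F 1F = - (q * (1# - q) ^ 2 * (1# + q) * x * (x - y) * D⁻¹)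
    weight 2F 0F 0F 2F =
      (1# - q ^ 2) * x * (x + q * x - q * y - q ^ 3 * y) * D⁻¹
    weight 1F 1F 2F 0F = - (q ^ 4 * (1# + q) * (x - y) * y * D⁻¹)
    weight 1F 1F 1F 1F =
      (- (q * x ^ 2) + (1# + q) * (1# - q ^ 2 + q ^ 4) * x * y - q ^ 4 * y ^ 2)
        * D⁻¹
    weight 1F 1F 0F 2F = (1# + q) * x * (x - y) * D⁻¹
    weight 0F 2F 2F 0F =
      (1# - q ^ 2) * (x + q ^ 2 * x - q ^ 2 * y - q ^ 3 * y) * y * D⁻¹
    weight 0F 2F 1F 1F = q * (1# - q) ^ 2 * (1# + q) * (x - y) * y * D⁻¹
    weight 0F 2F 0F 2F = (x - y) * (x - q * y) * D⁻¹
    weight _  _  _  _  = 0#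

  AllRegular : ∀ {n} → (Fin n → Carrier) → (ℕ → Carrier) → Set ℓ₂
  AllRegular x z = ∀ r c → Regular (z c) (x r)

  configWeight : ∀ {n L} (x : Fin n → Carrier) (z : ℕ → Carrier) →
                 AllRegular x z → Config n L → Carrier
  configWeight x z reg κ = ∏ λ r → ∏ λ c →
    W (z (toℕ c)) (x r) (reg r (toℕ c))
      (ver κ (inject₁ r) c) (hor κ r (inject₁ c))
      (ver κ (suc r) c)     (hor κ r (suc c))

  partitionFunction : ∀ {n L} → Boundary L →
                      (x : Fin n → Carrier) (z : ℕ → Carrier) →
                      AllRegular x z → Carrier
  partitionFunction {n} {L} b x z reg =
    foldr _+_ 0#
      (map (configWeight x z reg) (filter (obeys? b) (allConfigs n L)))

  -- The number of columns L is an explicit argument of F and G.  They are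
  -- F_S and G_S only if S vanishes from L on, |S| = 2 × N (N being the
  -- number of variables in the case of F) and, for G, N ≤ L.
  F : ∀ {N} (L : ℕ) (S : TwoString) (x : Fin N → Carrier) (z : ℕ → Carrier) →
      AllRegular x z → Carrier
  F L S = partitionFunction (boundaryF S L)

  G : ∀ {M} (N L : ℕ) (S : TwoString) (y : Fin M → Carrier)
      (z : ℕ → Carrier) → AllRegular y z → Carrier
  G N L S = partitionFunction (boundaryG N S L)

  Symmetric : ∀ {n} → ((x : Fin n → Carrier) (z : ℕ → Carrier) →
                       AllRegular x z → Carrier) → Set (k ⊔ ℓ₁ ⊔ ℓ₂)
  Symmetric {n} f =
    ∀ (σ : Permutation′ n) x z
      (reg : AllRegular x z) (regσ : AllRegular (x ∘ (σ ⟨$⟩ʳ_)) z) →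
    f (x ∘ (σ ⟨$⟩ʳ_)) z regσ ≈ f x z reg

{-# OPTIONS --safe #-}
module Submission where

-- The row-to-row transfer operators of the Izergin-Korepin model with the left
-- boundary state and the right boundary state each fixed to 0 or 2 commute, and
-- F and G are matrix entries of products of such operators, one for each
-- variable.  Hence permuting the variables does not change F or G.
--
-- Partition function.  The sum over all labellings that obey the boundary
-- conditions factors row by row: it is the entry of a product of operators
-- `transfer`, taken between the bottom and the top labelling (`∑-configs`).  A
-- product of pairwise commuting operators does not depend on their order
-- (`FoldCommuting.apply-permute`).
--
-- Commutation.  After clearing denominators, the weights satisfy the Yang-Baxter
-- equation with the crossing weights W_{x′/x} of two rows with parameters x and
-- x′.  Its 3⁶ components are identities of polynomials with integer coefficients
-- in x, x′, z and q; they are verified by computing normal forms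
-- (`yang-baxter-check`), and so hold in every commutative ring (`yang-baxter`).
-- Moving the crossing through all columns of two adjacent rows (`train`), and
-- using that a crossing with two equal incoming, or two equal outgoing, states 0
-- or 2 is D times the identity, D = (x - q²x′)(x - q³x′), gives D · P = D · Q,
-- where P and Q are the entries of the two-row operator with the rows in either
-- order (`line²-swap`).
--
-- Cancelling D.  The factor D may vanish at the point under consideration, so
-- that it cannot be divided out in the field K.  The identity D · P = D · Q is
-- therefore used in the ring K[t]/(t³), with x + t in place of x.  This is
-- possible because it holds in every commutative ring, and because the
-- reciprocals in the weights enter only as overall factors of vertices, which may be
-- lifted to K[t]/(t³) as constants.  There D = (a + t)(b + t) with a, b in K,
-- and over a field such a product determines the constant term of the other
-- factor (`cancel-quadratic`).  Thus P = Q at t = 0 (`line²-commute`).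

open import Defs
open import Algebra.Apartness.Bundles using (HeytingCommutativeRing; HeytingField)
open import Algebra.Bundles using (CommutativeRing)
import Algebra.Properties.AbelianGroup as AbelianGroupProperties
import Algebra.Properties.CommutativeMonoid.Sum as Product
import Algebra.Properties.Ring as RingProperties
import Algebra.Properties.Semiring.Exp as Exp
import Algebra.Properties.Semiring.Exp.TCOptimised as Exp′
import Algebra.Properties.Semiring.Mult.TCOptimised as Mult
open import Data.Bool.Base using (Bool; true; false; _∧_; if_then_else_)
open import Data.Bool.Properties using (∧-conicalˡ; ∧-conicalʳ)
open import Data.Fin.Base using (Fin; zero; suc; toℕ; fromℕ; inject₁; punchIn)
open import Data.Fin.Patterns using (0F; 1F; 2F; 3F)
open import Data.Fin.Permutation as Permutation using (Permutation′; _⟨$⟩ʳ_)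
import Data.Fin.Properties as Fin
open import Data.Integer.Base as ℤ using (ℤ; +_; -[1+_])
import Data.Integer.Properties as ℤ
open import Data.List.Base
  using (List; []; _∷_; _++_; map; foldr; filter; allFin; cartesianProduct; cartesianProductWith)
import Data.List.Properties as List
open import Data.Maybe.Base using (nothing)
open import Data.Nat.Base as ℕ using (ℕ; zero; suc)
import Data.Nat.Properties as ℕ
open import Data.Product.Base using (_×_; _,_; proj₁; proj₂)
open import Data.Sum.Base using (_⊎_; inj₁; inj₂)
open import Data.Vec.Base as Vec using (Vec; []; _∷_; lookup; tabulate)
import Data.Vec.Functional as Vector
import Data.Vec.Properties as Vec
open import Function.Base using (_∘_; _$_)
open import Relation.Binary.Bundles using (Setoid)
open import Relation.Binary.PropositionalEquality as ≡ using (_≡_)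
import Relation.Binary.Reasoning.Setoid as SetoidReasoning
import Relation.Binary.Reflection as Reflection
open import Relation.Nullary.Decidable using (Dec; yes; no; does; _×-dec_; dec-true; dec-false)
open import Relation.Unary using (Decidable)
open import Tactic.RingSolver.Core.AlmostCommutativeRing using (fromCommutativeRing)
open import Tactic.RingSolver.Core.Expression
  using (Expr; Κ; Ι; _⊕_; _⊗_; _⊛_; ⊝_; module Eval)
import Tactic.RingSolver.Core.Polynomial.Base as NormalForm
import Tactic.RingSolver.Core.Polynomial.Homomorphism as NormalHomomorphism
open import Tactic.RingSolver.Core.Polynomial.Parameters using (RawCoeff; Homomorphism)
import Tactic.RingSolver.Core.Polynomial.Semantics as NormalSemantics

-- Polynomial identities with integer coefficients

-- Zero test for coefficients, by which normal forms drop vanishing terms.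
isZero : ℤ → Bool
isZero (+ zero) = true
isZero _        = false

ℤ-coefficients : RawCoeff _ _
ℤ-coefficients = record { rawRing = ℤ.+-*-rawRing ; isZero = isZero }

module ℤ[X] = NormalForm ℤ-coefficients
open ℤ[X] using (Poly; _⊐_)

normalise : ∀ {n} → Expr ℤ n → Poly n
normalise (Κ x)   = ℤ[X].κ x
normalise (Ι x)   = ℤ[X].ι x
normalise (x ⊕ y) = normalise x ℤ[X].⊞ normalise y
normalise (x ⊗ y) = normalise x ℤ[X].⊠ normalise y
normalise (⊝ x)   = ℤ[X].⊟ normalise x
normalise (x ⊛ i) = normalise x ℤ[X].⊡ i

-- Whether a normal form is the zero polynomial; only the constant 0 is.
vanishes : ∀ {n} → Poly n → Bool
vanishes (ℤ[X].Κ x ⊐ _) = isZero x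
vanishes (ℤ[X].⅀ _ ⊐ _) = false

module _ {n : ℕ} where
  infixl 6 _⊖_
  infixr 8 _↑_

  _⊖_ : Expr ℤ n → Expr ℤ n → Expr ℤ n
  a ⊖ b = a ⊕ ⊝ b

  𝟘 𝟙 : Expr ℤ n
  𝟘 = Κ (+ 0)
  𝟙 = Κ (+ 1)

  -- Powers with the unfolding of the exponentiation in the vertex weights, which
  -- _⊛_ does not have.
  _↑_ : Expr ℤ n → ℕ → Expr ℤ n
  a ↑ zero  = 𝟙
  a ↑ suc k = a ⊗ a ↑ k

-- Equality of two expressions as polynomials with integer coefficients.
identical : ∀ {n} → Expr ℤ n → Expr ℤ n → Bool
identical a b = vanishes (normalise (a ⊖ b))

-- Simultaneous substitution of expressions for the variables.
substitute : ∀ {m n} → Vec (Expr ℤ n) m → Expr ℤ m → Expr ℤ n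
substitute σ (Κ x)   = Κ x
substitute σ (Ι i)   = lookup σ i
substitute σ (a ⊕ b) = substitute σ a ⊕ substitute σ b
substitute σ (a ⊗ b) = substitute σ a ⊗ substitute σ b
substitute σ (a ⊛ k) = substitute σ a ⊛ k
substitute σ (⊝ a)   = ⊝ substitute σ a

-- Evaluation of expressions in a commutative ring R along the unique ring
-- homomorphism from ℤ to R.
module Evaluation {c ℓ} (R : CommutativeRing c ℓ) where
  open CommutativeRing R
  open Mult semiring using (×-homo-+; ×1-homo-*; 1+×) renaming (_×_ to _·_)
  open Exp′ semiring using (_^_; ^-congˡ)
  open RingProperties ring using (-‿distribˡ-*; -‿distribʳ-*; -0#≈0#; -‿involutive)
  open AbelianGroupProperties +-abelianGroup using (⁻¹-∙-comm)
  open SetoidReasoning setoid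

  fromℤ : ℤ → Carrier
  fromℤ (+ n)    = n · 1#
  fromℤ -[1+ n ] = - (suc n · 1#)

  fromℤ-⊖ : ∀ m n → fromℤ (m ℤ.⊖ n) ≈ m · 1# - n · 1#
  fromℤ-⊖ zero    zero    = sym (-‿inverseʳ 0#)
  fromℤ-⊖ (suc m) zero    = sym (trans (+-congˡ -0#≈0#) (+-identityʳ _))
  fromℤ-⊖ zero    (suc n) = sym (+-identityˡ _)
  fromℤ-⊖ (suc m) (suc n) = begin
    fromℤ (suc m ℤ.⊖ suc n)                  ≡⟨ ≡.cong fromℤ (ℤ.[1+m]⊖[1+n]≡m⊖n m n) ⟩
    fromℤ (m ℤ.⊖ n)                          ≈⟨ fromℤ-⊖ m n ⟩
    a - b                                    ≈⟨ +-congʳ (+-identityˡ a) ⟨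
    0# + a - b                               ≈⟨ +-congʳ (+-congʳ (-‿inverseʳ 1#)) ⟨
    1# - 1# + a - b                          ≈⟨ +-congʳ (+-assoc 1# (- 1#) a) ⟩
    1# + (- 1# + a) - b                      ≈⟨ +-congʳ (+-congˡ (+-comm (- 1#) a)) ⟩
    1# + (a - 1#) - b                        ≈⟨ +-congʳ (+-assoc 1# a (- 1#)) ⟨
    1# + a - 1# - b                          ≈⟨ +-assoc (1# + a) (- 1#) (- b) ⟩
    1# + a + (- 1# - b)                      ≈⟨ +-congˡ (⁻¹-∙-comm 1# b) ⟩
    1# + a - (1# + b)                        ≈⟨ +-cong (1+× m 1#) (-‿cong (1+× n 1#)) ⟨
    suc m · 1# - suc n · 1#                  ∎
    where
    a = m · 1#
    b = n · 1#

  fromℤ-neg : ∀ i → fromℤ (ℤ.- i) ≈ - fromℤ i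
  fromℤ-neg (+ zero)   = sym -0#≈0#
  fromℤ-neg (+ suc n)  = refl
  fromℤ-neg (-[1+ n ]) = sym (-‿involutive _)

  fromℤ-+ : ∀ i j → fromℤ (i ℤ.+ j) ≈ fromℤ i + fromℤ j
  fromℤ-+ (+ m)    (+ n)    = ×-homo-+ 1# m n
  fromℤ-+ (+ m)    -[1+ n ] = fromℤ-⊖ m (suc n)
  fromℤ-+ -[1+ m ] (+ n)    = trans (fromℤ-⊖ n (suc m)) (+-comm _ _)
  fromℤ-+ -[1+ m ] -[1+ n ] = begin
    - (suc (suc (m ℕ.+ n)) · 1#)       ≡⟨ ≡.cong (λ k → - (suc k · 1#)) (ℕ.+-suc m n) ⟨
    - ((suc m ℕ.+ suc n) · 1#)         ≈⟨ -‿cong (×-homo-+ 1# (suc m) (suc n)) ⟩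
    - (suc m · 1# + suc n · 1#)        ≈⟨ ⁻¹-∙-comm _ _ ⟨
    - (suc m · 1#) - suc n · 1#        ∎

  fromℤ-*⁺ : ∀ m j → fromℤ (+ m ℤ.* j) ≈ fromℤ (+ m) * fromℤ j
  fromℤ-*⁺ m (+ n) = begin
    fromℤ (+ m ℤ.* + n)     ≡⟨ ≡.cong fromℤ (ℤ.pos-* m n) ⟨
    (m ℕ.* n) · 1#          ≈⟨ ×1-homo-* m n ⟩
    m · 1# * n · 1#         ∎
  fromℤ-*⁺ m -[1+ n ] = begin
    fromℤ (+ m ℤ.* ℤ.- + suc n)      ≡⟨ ≡.cong fromℤ (ℤ.neg-distribʳ-* (+ m) (+ suc n)) ⟨
    fromℤ (ℤ.- (+ m ℤ.* + suc n))    ≈⟨ fromℤ-neg (+ m ℤ.* + suc n) ⟩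
    - fromℤ (+ m ℤ.* + suc n)        ≈⟨ -‿cong (fromℤ-*⁺ m (+ suc n)) ⟩
    - (m · 1# * suc n · 1#)          ≈⟨ -‿distribʳ-* _ _ ⟩
    m · 1# * - (suc n · 1#)          ∎

  fromℤ-* : ∀ i j → fromℤ (i ℤ.* j) ≈ fromℤ i * fromℤ j
  fromℤ-* (+ m)    j = fromℤ-*⁺ m j
  fromℤ-* -[1+ m ] j = begin
    fromℤ (ℤ.- + suc m ℤ.* j)        ≡⟨ ≡.cong fromℤ (ℤ.neg-distribˡ-* (+ suc m) j) ⟨
    fromℤ (ℤ.- (+ suc m ℤ.* j))      ≈⟨ fromℤ-neg (+ suc m ℤ.* j) ⟩
    - fromℤ (+ suc m ℤ.* j)          ≈⟨ -‿cong (fromℤ-*⁺ (suc m) j) ⟩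
    - (suc m · 1# * fromℤ j)         ≈⟨ -‿distribˡ-* _ _ ⟩
    - (suc m · 1#) * fromℤ j         ∎

  ℤ-homomorphism : Homomorphism _ _ _ _
  ℤ-homomorphism = record
    { from     = ℤ-coefficients
    ; to       = fromCommutativeRing R (λ _ → nothing)
    ; morphism = record
        { ⟦_⟧    = fromℤ
        ; +-homo = fromℤ-+
        ; *-homo = fromℤ-*
        ; -‿homo = fromℤ-neg
        ; 0-homo = refl
        ; 1-homo = refl
        }
    ; Zero-C⟶Zero-R = λ { (+ zero) _ → refl }
    }

  open Eval rawRing fromℤ public using (⟦_⟧)
  open NormalSemantics ℤ-homomorphism using () renaming (⟦_⟧ to ⟦_⟧ₚ)
  open NormalHomomorphism ℤ-homomorphism

  ⟦_⇓⟧ : ∀ {n} → Expr ℤ n → Vec Carrier n → Carrier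
  ⟦ e ⇓⟧ = ⟦ normalise e ⟧ₚ

  -- An expression and its normal form have the same value.
  normalise-correct : ∀ {n} (e : Expr ℤ n) ρ → ⟦ e ⇓⟧ ρ ≈ ⟦ e ⟧ ρ
  normalise-correct (Κ x)   ρ = κ-hom x ρ
  normalise-correct (Ι x)   ρ = ι-hom x ρ
  normalise-correct (x ⊕ y) ρ = trans (⊞-hom (normalise x) (normalise y) ρ)
                                      (+-cong (normalise-correct x ρ) (normalise-correct y ρ))
  normalise-correct (x ⊗ y) ρ = trans (⊠-hom (normalise x) (normalise y) ρ)
                                      (*-cong (normalise-correct x ρ) (normalise-correct y ρ))
  normalise-correct (⊝ x)   ρ = trans (⊟-hom (normalise x) ρ) (-‿cong (normalise-correct x ρ))
  normalise-correct (x ⊛ i) ρ = trans (⊡-hom (normalise x) i ρ)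
                                      (^-congˡ i (normalise-correct x ρ))

  open Reflection setoid Ι ⟦_⟧ ⟦_⇓⟧ normalise-correct public using (solve; _⊜_)

  vanishes-correct : ∀ {n} (p : Poly n) → vanishes p ≡ true → ∀ ρ → ⟦ p ⟧ₚ ρ ≈ 0#
  vanishes-correct (ℤ[X].Κ (+ zero) ⊐ _) _ ρ = refl

  identical-correct : ∀ {n} (a b : Expr ℤ n) → identical a b ≡ true → ∀ ρ → ⟦ a ⟧ ρ ≈ ⟦ b ⟧ ρ
  identical-correct a b a≡b ρ = begin
    ⟦ a ⟧ ρ                          ≈⟨ +-identityʳ _ ⟨
    ⟦ a ⟧ ρ + 0#                     ≈⟨ +-congˡ (-‿inverseˡ _) ⟨
    ⟦ a ⟧ ρ + (- ⟦ b ⟧ ρ + ⟦ b ⟧ ρ)  ≈⟨ +-assoc _ _ _ ⟨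
    ⟦ a ⊖ b ⟧ ρ + ⟦ b ⟧ ρ            ≈⟨ +-congʳ (normalise-correct (a ⊖ b) ρ) ⟨
    ⟦ a ⊖ b ⇓⟧ ρ + ⟦ b ⟧ ρ           ≈⟨ +-congʳ (vanishes-correct (normalise (a ⊖ b)) a≡b ρ) ⟩
    0# + ⟦ b ⟧ ρ                     ≈⟨ +-identityˡ _ ⟩
    ⟦ b ⟧ ρ                          ∎

  substitute-correct : ∀ {m n} (σ : Vec (Expr ℤ n) m) e ρ →
                       ⟦ substitute σ e ⟧ ρ ≡ ⟦ e ⟧ (Vec.map (λ a → ⟦ a ⟧ ρ) σ)
  substitute-correct σ (Κ x)   ρ = ≡.refl
  substitute-correct σ (Ι i)   ρ = ≡.sym (Vec.lookup-map i (λ a → ⟦ a ⟧ ρ) σ)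
  substitute-correct σ (a ⊕ b) ρ = ≡.cong₂ _+_ (substitute-correct σ a ρ) (substitute-correct σ b ρ)
  substitute-correct σ (a ⊗ b) ρ = ≡.cong₂ _*_ (substitute-correct σ a ρ) (substitute-correct σ b ρ)
  substitute-correct σ (a ⊛ k) ρ = ≡.cong (_^ k) (substitute-correct σ a ρ)
  substitute-correct σ (⊝ a)   ρ = ≡.cong -_ (substitute-correct σ a ρ)

-- Products of commuting operators

-- Composites of finite families of commuting endomaps of a setoid.
module FoldCommuting {a ℓ} (X : Setoid a ℓ) where
  open Setoid X
  open SetoidReasoning X

  Congruent Commuting : ∀ {n} → (Fin n → Carrier → Carrier) → Set _
  Congruent A = ∀ i {x y} → x ≈ y → A i x ≈ A i y
  Commuting A = ∀ i j x → A i (A j x) ≈ A j (A i x)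

  -- A 0 (A 1 (… (A (n - 1) x))).
  apply : ∀ {n} → (Fin n → Carrier → Carrier) → Carrier → Carrier
  apply A x = Vector.foldr _$_ x A

  apply-cong : ∀ {n} (A B : Fin n → Carrier → Carrier) → Congruent A →
               (∀ i x → A i x ≈ B i x) → ∀ x → apply A x ≈ apply B x
  apply-cong {zero}  A B A-cong A≈B x = refl
  apply-cong {suc n} A B A-cong A≈B x =
    trans (A-cong zero (apply-cong (A ∘ suc) (B ∘ suc) (A-cong ∘ suc) (A≈B ∘ suc) x))
          (A≈B zero _)

  -- Any factor can be moved to the front.
  apply-remove : ∀ {n} (A : Fin (suc n) → Carrier → Carrier) → Congruent A → Commuting A →
                 ∀ i x → apply A x ≈ A i (apply (A ∘ punchIn i) x)
  apply-remove         A A-cong comm zero    x = refl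
  apply-remove {suc n} A A-cong comm (suc i) x = begin
    A zero (apply (A ∘ suc) x)
      ≈⟨ A-cong zero (apply-remove (A ∘ suc) (A-cong ∘ suc) (λ j k → comm (suc j) (suc k)) i x) ⟩
    A zero (A (suc i) (apply (A ∘ suc ∘ punchIn i) x))
      ≈⟨ comm zero (suc i) _ ⟩
    A (suc i) (A zero (apply (A ∘ suc ∘ punchIn i) x))  ∎

  apply-permute : ∀ {n} (A : Fin n → Carrier → Carrier) → Congruent A → Commuting A →
                  ∀ (σ : Permutation′ n) x → apply (A ∘ (σ ⟨$⟩ʳ_)) x ≈ apply A x
  apply-permute {zero}  A A-cong comm σ x = refl
  apply-permute {suc n} A A-cong comm σ x = begin
    A i (apply (A ∘ (σ ⟨$⟩ʳ_) ∘ suc) x)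
      ≈⟨ A-cong i (apply-cong _ _ (λ j → A-cong (σ ⟨$⟩ʳ suc j))
           (λ j y → reflexive (≡.cong (λ k → A k y) (Permutation.punchIn-permute σ zero j))) x) ⟩
    A i (apply (A ∘ punchIn i ∘ (Permutation.remove zero σ ⟨$⟩ʳ_)) x)
      ≈⟨ A-cong i (apply-permute (A ∘ punchIn i) (A-cong ∘ punchIn i)
           (λ j k → comm (punchIn i j) (punchIn i k)) (Permutation.remove zero σ) x) ⟩
    A i (apply (A ∘ punchIn i) x)
      ≈⟨ apply-remove A A-cong comm i x ⟨
    apply A x  ∎
    where i = σ ⟨$⟩ʳ zero

-- Finite sums and indicators

module Sums {c ℓ} (R : CommutativeRing c ℓ) where
  open CommutativeRing R hiding (zero)
  open Evaluation R using (solve; _⊜_)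
  open SetoidReasoning setoid
  open Product *-commutativeMonoid using () renaming (sum to ∏)
  private variable
    A B C : Set

  opaque
    -- Opaque, since a sum over the closed list of all states would otherwise unfold
    -- to its three terms.
    ∑ : List A → (A → Carrier) → Carrier
    ∑ xs f = foldr _+_ 0# (map f xs)

    ∑-cong : ∀ (xs : List A) {f g : A → Carrier} → (∀ x → f x ≈ g x) → ∑ xs f ≈ ∑ xs g
    ∑-cong []       f≈g = refl
    ∑-cong (x ∷ xs) f≈g = +-cong (f≈g x) (∑-cong xs f≈g)

    ∑-0 : ∀ (xs : List A) → ∑ xs (λ _ → 0#) ≈ 0#
    ∑-0 []       = refl
    ∑-0 (x ∷ xs) = trans (+-identityˡ _) (∑-0 xs)

    ∑-+ : ∀ (xs : List A) (f g : A → Carrier) → ∑ xs (λ x → f x + g x) ≈ ∑ xs f + ∑ xs g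
    ∑-+ []       f g = sym (+-identityˡ 0#)
    ∑-+ (x ∷ xs) f g = trans (+-congˡ (∑-+ xs f g))
      (solve 4 (λ a b c d → (a ⊕ b) ⊕ (c ⊕ d) ⊜ (a ⊕ c) ⊕ (b ⊕ d)) refl _ _ _ _)

    *-∑ : ∀ a (xs : List A) (f : A → Carrier) → a * ∑ xs f ≈ ∑ xs (λ x → a * f x)
    *-∑ a []       f = zeroʳ a
    *-∑ a (x ∷ xs) f = trans (distribˡ _ _ _) (+-congˡ (*-∑ a xs f))

    ∑-* : ∀ (xs : List A) (f : A → Carrier) a → ∑ xs f * a ≈ ∑ xs (λ x → f x * a)
    ∑-* []       f a = zeroˡ a
    ∑-* (x ∷ xs) f a = trans (distribʳ _ _ _) (+-congˡ (∑-* xs f a))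

    ∑-swap : ∀ (xs : List A) (ys : List B) (f : A → B → Carrier) →
             ∑ xs (λ x → ∑ ys (f x)) ≈ ∑ ys (λ y → ∑ xs (λ x → f x y))
    ∑-swap []       ys f = sym (∑-0 ys)
    ∑-swap (x ∷ xs) ys f = trans (+-congˡ (∑-swap xs ys f)) (sym (∑-+ ys _ _))

    ∑-++ : ∀ (xs ys : List A) (f : A → Carrier) → ∑ (xs ++ ys) f ≈ ∑ xs f + ∑ ys f
    ∑-++ []       ys f = sym (+-identityˡ _)
    ∑-++ (x ∷ xs) ys f = trans (+-congˡ (∑-++ xs ys f)) (sym (+-assoc _ _ _))

    ∑-map : ∀ (g : A → B) xs (f : B → Carrier) → ∑ (map g xs) f ≡ ∑ xs (f ∘ g)
    ∑-map g xs f = ≡.cong (foldr _+_ 0#) (≡.sym (List.map-∘ xs))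

    ∑-cartesianProductWith : ∀ (g : A → B → C) xs ys (f : C → Carrier) →
      ∑ (cartesianProductWith g xs ys) f ≈ ∑ xs (λ x → ∑ ys (λ y → f (g x y)))
    ∑-cartesianProductWith g []       ys f = refl
    ∑-cartesianProductWith g (x ∷ xs) ys f =
      trans (∑-++ (map (g x) ys) _ f)
            (+-cong (reflexive (∑-map (g x) ys f)) (∑-cartesianProductWith g xs ys f))

    ∑-definition : ∀ (xs : List A) (f : A → Carrier) → ∑ xs f ≡ foldr _+_ 0# (map f xs)
    ∑-definition xs f = ≡.refl

  -- The truth value of a decided proposition, as 0 or 1 in the ring.
  indicator : ∀ {P : Set} → Dec P → Carrier
  indicator P? = if does P? then 1# else 0#

  opaque
    unfolding ∑

    ∑-filter : ∀ {P : A → Set} (P? : Decidable P) xs (f : A → Carrier) →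
               ∑ (filter P? xs) f ≈ ∑ xs (λ x → indicator (P? x) * f x)
    ∑-filter P? []       f = refl
    ∑-filter P? (x ∷ xs) f with does (P? x)
    ... | true  = +-cong (sym (*-identityˡ _)) (∑-filter P? xs f)
    ... | false = trans (∑-filter P? xs f) (sym (trans (+-congʳ (zeroˡ _)) (+-identityˡ _)))

  indicator-⇔ : ∀ {P Q : Set} (P? : Dec P) (Q? : Dec Q) → (P → Q) → (Q → P) →
                indicator P? ≡ indicator Q?
  indicator-⇔ (yes p) Q?      p⇒q q⇒p rewrite dec-true Q? (p⇒q p)      = ≡.refl
  indicator-⇔ (no ¬p) Q?      p⇒q q⇒p rewrite dec-false Q? (¬p ∘ q⇒p) = ≡.refl

  indicator-× : ∀ {P Q : Set} (P? : Dec P) (Q? : Dec Q) →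
                indicator (P? ×-dec Q?) ≈ indicator P? * indicator Q?
  indicator-× P? Q? with does P?
  ... | true  = sym (*-identityˡ _)
  ... | false = sym (zeroˡ _)

  indicator-∀ : ∀ {n} {P : Fin n → Set} (P? : Decidable P) →
                indicator (Fin.all? P?) ≈ ∏ (λ i → indicator (P? i))
  indicator-∀ {zero}  P? = refl
  indicator-∀ {suc n} P? = begin
    indicator (Fin.all? P?)
      ≡⟨ indicator-⇔ (Fin.all? P?) (P? zero ×-dec Fin.all? (P? ∘ suc))
           (λ p → p zero , p ∘ suc) (λ { (p , q) → λ { zero → p ; (suc i) → q i } }) ⟩
    indicator (P? zero ×-dec Fin.all? (P? ∘ suc))
      ≈⟨ indicator-× (P? zero) (Fin.all? (P? ∘ suc)) ⟩
    indicator (P? zero) * indicator (Fin.all? (P? ∘ suc))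
      ≈⟨ *-congˡ (indicator-∀ (P? ∘ suc)) ⟩
    indicator (P? zero) * ∏ (λ i → indicator (P? (suc i)))  ∎

  states : List State
  states = allFin 3

  δ : State → State → Carrier
  δ s t = indicator (s Fin.≟ t)

  opaque
    unfolding ∑

    ∑-δ : ∀ t (f : State → Carrier) → ∑ states (λ s → δ s t * f s) ≈ f t
    ∑-δ 0F f = solve 3 (λ a b c → 𝟙 ⊗ a ⊕ (𝟘 ⊗ b ⊕ (𝟘 ⊗ c ⊕ 𝟘)) ⊜ a) refl _ _ _
    ∑-δ 1F f = solve 3 (λ a b c → 𝟘 ⊗ a ⊕ (𝟙 ⊗ b ⊕ (𝟘 ⊗ c ⊕ 𝟘)) ⊜ b) refl _ _ _
    ∑-δ 2F f = solve 3 (λ a b c → 𝟘 ⊗ a ⊕ (𝟘 ⊗ b ⊕ (𝟙 ⊗ c ⊕ 𝟘)) ⊜ c) refl _ _ _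

  opaque
    unfolding ∑

    ∑-singleton : ∀ (x : A) (f : A → Carrier) → ∑ (x ∷ []) f ≈ f x
    ∑-singleton x f = +-identityʳ _

  -- All labellings of L vertical edges.
  strings : ∀ L → List (Vec State L)
  strings = allVecs states

  _≟ᵛ_ : ∀ {L} (u v : Vec State L) → Dec (u ≡ v)
  _≟ᵛ_ = Vec.≡-dec Fin._≟_

  ∑-strings : ∀ L (f : Vec State (suc L) → Carrier) →
              ∑ (strings (suc L)) f ≈ ∑ states (λ s → ∑ (strings L) (λ v → f (s ∷ v)))
  ∑-strings L f = ∑-cartesianProductWith _∷_ states (strings L) f

  ∑-δᵛ : ∀ {L} (u : Vec State L) (f : Vec State L → Carrier) →
         ∑ (strings L) (λ v → indicator (v ≟ᵛ u) * f v) ≈ f u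
  ∑-δᵛ {zero}  []      f = trans (∑-singleton [] _) (*-identityˡ _)
  ∑-δᵛ {suc L} (t ∷ u) f = begin
    ∑ (strings (suc L)) (λ v → indicator (v ≟ᵛ (t ∷ u)) * f v)
      ≈⟨ ∑-strings L _ ⟩
    ∑ states (λ s → ∑ (strings L) (λ v → indicator ((s ∷ v) ≟ᵛ (t ∷ u)) * f (s ∷ v)))
      ≈⟨ ∑-cong states (λ s → ∑-cong (strings L) (λ v → trans (*-congʳ (split s v)) (*-assoc _ _ _))) ⟩
    ∑ states (λ s → ∑ (strings L) (λ v → δ s t * (indicator (v ≟ᵛ u) * f (s ∷ v))))
      ≈⟨ ∑-cong states (λ s → *-∑ (δ s t) (strings L) _) ⟨
    ∑ states (λ s → δ s t * ∑ (strings L) (λ v → indicator (v ≟ᵛ u) * f (s ∷ v)))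
      ≈⟨ ∑-δ t _ ⟩
    ∑ (strings L) (λ v → indicator (v ≟ᵛ u) * f (t ∷ v))
      ≈⟨ ∑-δᵛ u _ ⟩
    f (t ∷ u)  ∎
    where
    split : ∀ s v → indicator ((s ∷ v) ≟ᵛ (t ∷ u)) ≈ δ s t * indicator (v ≟ᵛ u)
    split s v = trans
      (reflexive (indicator-⇔ ((s ∷ v) ≟ᵛ (t ∷ u)) ((s Fin.≟ t) ×-dec (v ≟ᵛ u))
        Vec.∷-injective (λ { (≡.refl , ≡.refl) → ≡.refl })))
      (indicator-× (s Fin.≟ t) (v ≟ᵛ u))

-- Row-to-row operators and the partition function

module Lattice {c ℓ} (R : CommutativeRing c ℓ) where
  open CommutativeRing R hiding (zero)
  open Evaluation R using (solve; _⊜_)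
  open Sums R
  open Product *-commutativeMonoid using () renaming (sum to ∏)
  open SetoidReasoning setoid

  -- Weights of a single vertex, with arguments bottom, left, top, right.
  Weight : Set c
  Weight = (i j k ℓ : State) → Carrier

  -- Weight of one row with left state ℓ, right state r, bottom labels u and top
  -- labels v, summed over the inner horizontal edges.
  line : ∀ {L} → (Fin L → Weight) → (ℓ r : State) → (u v : Vec State L) → Carrier
  line {zero}  w ℓ r []      []      = δ ℓ r
  line {suc L} w ℓ r (a ∷ u) (b ∷ v) = ∑ states λ m → w zero a ℓ b m * line (w ∘ suc) m r u v

  -- The transfer operator of one row, with the states at both ends fixed, on
  -- functions of the labelling above the row.
  transfer : ∀ {L} → (Fin L → Weight) → (ℓ r : State) →
             (Vec State L → Carrier) → (Vec State L → Carrier)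
  transfer {L} w ℓ r f u = ∑ (strings L) λ v → line w ℓ r u v * f v

  -- Weight of one row in which all edges are labelled.
  rowWeight : ∀ {L} → (Fin L → Weight) → Vec State (suc L) → (u v : Vec State L) → Carrier
  rowWeight w h u v = ∏ λ c → w c (lookup u c) (lookup h (inject₁ c)) (lookup v c) (lookup h (suc c))

  module _ {L : ℕ} where
    first last : Vec State (suc L) → State
    first h = lookup h zero
    last  h = lookup h (fromℕ L)

  -- Summing over the horizontal labels other than the leftmost one.
  ∑-rowWeight-from : ∀ {L} (w : Fin L → Weight) ℓ r u v →
    ∑ (strings L) (λ h → δ (last (ℓ ∷ h)) r * rowWeight w (ℓ ∷ h) u v) ≈ line w ℓ r u v
  ∑-rowWeight-from {zero}  w ℓ r []      []      = trans (∑-singleton [] _) (*-identityʳ _)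
  ∑-rowWeight-from {suc L} w ℓ r (a ∷ u) (b ∷ v) = begin
    ∑ (strings (suc L)) (λ h → δ (last (ℓ ∷ h)) r * rowWeight w (ℓ ∷ h) (a ∷ u) (b ∷ v))
      ≈⟨ ∑-strings L _ ⟩
    ∑ states (λ m → ∑ (strings L) (λ h →
      δ (last (m ∷ h)) r * (w zero a ℓ b m * rowWeight (w ∘ suc) (m ∷ h) u v)))
      ≈⟨ ∑-cong states (λ m → ∑-cong (strings L) (λ h →
           solve 3 (λ x y z → x ⊗ (y ⊗ z) ⊜ y ⊗ (x ⊗ z)) refl
             (δ (last (m ∷ h)) r) (w zero a ℓ b m) (rowWeight (w ∘ suc) (m ∷ h) u v))) ⟩
    ∑ states (λ m → ∑ (strings L) (λ h →
      w zero a ℓ b m * (δ (last (m ∷ h)) r * rowWeight (w ∘ suc) (m ∷ h) u v)))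
      ≈⟨ ∑-cong states (λ m → *-∑ (w zero a ℓ b m) (strings L) _) ⟨
    ∑ states (λ m →
      w zero a ℓ b m * ∑ (strings L) (λ h → δ (last (m ∷ h)) r * rowWeight (w ∘ suc) (m ∷ h) u v))
      ≈⟨ ∑-cong states (λ m → *-congˡ (∑-rowWeight-from (w ∘ suc) m r u v)) ⟩
    line w ℓ r (a ∷ u) (b ∷ v)  ∎

  ∑-rowWeight : ∀ {L} (w : Fin L → Weight) ℓ r u v →
    ∑ (strings (suc L)) (λ h → δ (first h) ℓ * (δ (last h) r * rowWeight w h u v)) ≈ line w ℓ r u v
  ∑-rowWeight {L} w ℓ r u v = begin
    ∑ (strings (suc L)) (λ h → δ (first h) ℓ * (δ (last h) r * rowWeight w h u v))
      ≈⟨ ∑-strings L _ ⟩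
    ∑ states (λ s → ∑ (strings L) (λ h → δ s ℓ * (δ (last (s ∷ h)) r * rowWeight w (s ∷ h) u v)))
      ≈⟨ ∑-cong states (λ s → *-∑ (δ s ℓ) (strings L) _) ⟨
    ∑ states (λ s → δ s ℓ * ∑ (strings L) (λ h → δ (last (s ∷ h)) r * rowWeight w (s ∷ h) u v))
      ≈⟨ ∑-δ ℓ _ ⟩
    ∑ (strings L) (λ h → δ (last (ℓ ∷ h)) r * rowWeight w (ℓ ∷ h) u v)
      ≈⟨ ∑-rowWeight-from w ℓ r u v ⟩
    line w ℓ r u v  ∎

  -- The space on which transfer operators act.
  rowFunctions : ∀ L → Setoid c ℓ
  rowFunctions L = record
    { Carrier       = Vec State L → Carrier
    ; _≈_           = λ f g → ∀ v → f v ≈ g v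
    ; isEquivalence = record
        { refl  = λ v → refl
        ; sym   = λ p v → sym (p v)
        ; trans = λ p q v → trans (p v) (q v)
        }
    }

  module _ {L : ℕ} where
    open FoldCommuting (rowFunctions L) public

  module _ {L : ℕ} (ℓ r : State) (t : Vec State L) where

    -- Weight of a labelled stack of n rows above the layer v, restricted to left
    -- states ℓ, right states r and top layer t.
    stack : ∀ {n} → (Fin n → Fin L → Weight) →
            Vec (Vec State (suc L)) n → Vec State L → Vec (Vec State L) n → Carrier
    stack {zero}  w []       v []        = indicator (v ≟ᵛ t)
    stack {suc n} w (h ∷ hs) v (v′ ∷ vs) =
      δ (first h) ℓ * (δ (last h) r * rowWeight (w zero) h v v′) * stack (w ∘ suc) hs v′ vs

    ∑-stack : ∀ {n} (w : Fin n → Fin L → Weight) v →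
      ∑ (allVecs (strings (suc L)) n) (λ hs → ∑ (allVecs (strings L) n) (stack w hs v))
        ≈ apply (λ i → transfer (w i) ℓ r) (λ v → indicator (v ≟ᵛ t)) v
    ∑-stack {zero}  w v = trans (∑-singleton [] _) (∑-singleton [] _)
    ∑-stack {suc n} w v = begin
      ∑ (allVecs (strings (suc L)) (suc n)) (λ hs → ∑ (allVecs (strings L) (suc n)) (stack w hs v))
        ≈⟨ ∑-cartesianProductWith _∷_ (strings (suc L)) H _ ⟩
      ∑ (strings (suc L)) (λ h → ∑ H (λ hs → ∑ (allVecs (strings L) (suc n)) (stack w (h ∷ hs) v)))
        ≈⟨ ∑-cong (strings (suc L)) (λ h → ∑-cong H (λ hs →
             ∑-cartesianProductWith _∷_ (strings L) V (stack w (h ∷ hs) v))) ⟩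
      ∑ (strings (suc L)) (λ h → ∑ H (λ hs → ∑ (strings L) (λ v′ → ∑ V (λ vs → X h v′ * Y hs v′ vs))))
        ≈⟨ ∑-cong (strings (suc L)) (λ h → ∑-swap H (strings L) _) ⟩
      ∑ (strings (suc L)) (λ h → ∑ (strings L) (λ v′ → ∑ H (λ hs → ∑ V (λ vs → X h v′ * Y hs v′ vs))))
        ≈⟨ ∑-swap (strings (suc L)) (strings L) _ ⟩
      ∑ (strings L) (λ v′ → ∑ (strings (suc L)) (λ h → ∑ H (λ hs → ∑ V (λ vs → X h v′ * Y hs v′ vs))))
        ≈⟨ ∑-cong (strings L) (λ v′ → ∑-cong (strings (suc L)) (λ h →
             trans (∑-cong H (λ hs → sym (*-∑ (X h v′) V (Y hs v′)))) (sym (*-∑ (X h v′) H _)))) ⟩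
      ∑ (strings L) (λ v′ → ∑ (strings (suc L)) (λ h → X h v′ * ∑ H (λ hs → ∑ V (Y hs v′))))
        ≈⟨ ∑-cong (strings L) (λ v′ → ∑-* (strings (suc L)) (λ h → X h v′) _) ⟨
      ∑ (strings L) (λ v′ → ∑ (strings (suc L)) (λ h → X h v′) * ∑ H (λ hs → ∑ V (Y hs v′)))
        ≈⟨ ∑-cong (strings L) (λ v′ →
             *-cong (∑-rowWeight (w zero) ℓ r v v′) (∑-stack (w ∘ suc) v′)) ⟩
      apply (λ i → transfer (w i) ℓ r) (λ v → indicator (v ≟ᵛ t)) v  ∎
      where
      H = allVecs (strings (suc L)) n
      V = allVecs (strings L) n
      X : Vec State (suc L) → Vec State L → Carrier
      X h v′ = δ (first h) ℓ * (δ (last h) r * rowWeight (w zero) h v v′)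
      Y : Vec (Vec State (suc L)) n → Vec State L → Vec (Vec State L) n → Carrier
      Y = stack (w ∘ suc)

    -- The boundary conditions of all rows can be collected in front of the vertex
    -- weights.
    stack-∏ : ∀ {n} (w : Fin n → Fin L → Weight) hs v vs →
      stack w hs v vs ≈
        ∏ (λ i → δ (first (lookup hs i)) ℓ) *
        (∏ (λ i → δ (last (lookup hs i)) r) * indicator (lookup (v ∷ vs) (fromℕ n) ≟ᵛ t)) *
        ∏ (λ i → rowWeight (w i) (lookup hs i) (lookup (v ∷ vs) (inject₁ i)) (lookup (v ∷ vs) (suc i)))
    stack-∏ {zero}  w []       v []        = solve 1 (λ x → x ⊜ 𝟙 ⊗ (𝟙 ⊗ x) ⊗ 𝟙) refl _
    stack-∏ {suc n} w (h ∷ hs) v (v′ ∷ vs) = trans (*-congˡ (stack-∏ (w ∘ suc) hs v′ vs))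
      (solve 7 (λ d e x d′ e′ i x′ → d ⊗ (e ⊗ x) ⊗ (d′ ⊗ (e′ ⊗ i) ⊗ x′) ⊜
                                     d ⊗ d′ ⊗ (e ⊗ e′ ⊗ i) ⊗ (x ⊗ x′))
        refl _ _ _ _ _ _ _)

  -- Weight of a configuration for arbitrary vertex weights.
  weightOf : ∀ {n L} → (Fin n → Fin L → Weight) → Config n L → Carrier
  weightOf w κ = ∏ λ i → ∏ λ c →
    w i c (ver κ (inject₁ i) c) (hor κ i (inject₁ c)) (ver κ (suc i) c) (hor κ i (suc c))

  module _ {n L : ℕ} (b : Boundary L) (w : Fin n → Fin L → Weight) where
    open Boundary b

    bottom-row top-row : Vec State L
    bottom-row = tabulate bottom
    top-row    = tabulate top

    ≟-tabulate : ∀ (v : Vec State L) f →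
                 indicator (Fin.all? (λ c → lookup v c Fin.≟ f c)) ≡ indicator (v ≟ᵛ tabulate f)
    ≟-tabulate v f = indicator-⇔ (Fin.all? (λ c → lookup v c Fin.≟ f c)) (v ≟ᵛ tabulate f)
      (λ p → ≡.trans (≡.sym (Vec.tabulate∘lookup v)) (Vec.tabulate-cong p))
      (λ { ≡.refl → Vec.lookup∘tabulate f })

    -- A configuration is its bottom layer together with a stack above it.
    obeys-indicator : ∀ hs v vs →
      indicator (obeys? b (hs , v ∷ vs)) * weightOf w (hs , v ∷ vs) ≈
        indicator (v ≟ᵛ bottom-row) * stack left right top-row w hs v vs
    obeys-indicator hs v vs = begin
      indicator (obeys? b κ) * weightOf w κ
        ≈⟨ *-congʳ (indicator-× left? (right? ×-dec bottom? ×-dec top?)) ⟩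
      indicator left? * indicator (right? ×-dec bottom? ×-dec top?) * weightOf w κ
        ≈⟨ *-congʳ (*-congˡ (trans (indicator-× right? (bottom? ×-dec top?))
                                   (*-congˡ (indicator-× bottom? top?)))) ⟩
      indicator left? * (indicator right? * (indicator bottom? * indicator top?)) * weightOf w κ
        ≈⟨ *-congʳ (*-cong (indicator-∀ (λ i → hor κ i zero Fin.≟ left))
             (*-cong (indicator-∀ (λ i → hor κ i (fromℕ L) Fin.≟ right))
               (reflexive (≡.cong₂ _*_ (≟-tabulate v bottom)
                                       (≟-tabulate (lookup (v ∷ vs) (fromℕ n)) top))))) ⟩
      ls * (rs * (ib * it)) * weightOf w κ
        ≈⟨ solve 5 (λ ls rs ib it x → ls ⊗ (rs ⊗ (ib ⊗ it)) ⊗ x ⊜ ib ⊗ (ls ⊗ (rs ⊗ it) ⊗ x))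
             refl ls rs ib it (weightOf w κ) ⟩
      ib * (ls * (rs * it) * weightOf w κ)
        ≈⟨ *-congˡ (stack-∏ left right top-row w hs v vs) ⟨
      ib * stack left right top-row w hs v vs  ∎
      where
      κ : Config n L
      κ = hs , v ∷ vs
      left?   = Fin.all? (λ i → hor κ i zero Fin.≟ left)
      right?  = Fin.all? (λ i → hor κ i (fromℕ L) Fin.≟ right)
      bottom? = Fin.all? (λ c → ver κ zero c Fin.≟ bottom c)
      top?    = Fin.all? (λ c → ver κ (fromℕ n) c Fin.≟ top c)
      ls = ∏ (λ i → δ (hor κ i zero) left)
      rs = ∏ (λ i → δ (hor κ i (fromℕ L)) right)
      ib = indicator (v ≟ᵛ bottom-row)
      it = indicator (lookup (v ∷ vs) (fromℕ n) ≟ᵛ top-row)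

    -- The partition function is an entry of a product of transfer operators.
    ∑-configs : foldr _+_ 0# (map (weightOf w) (filter (obeys? b) (allConfigs n L))) ≈
      apply (λ i → transfer (w i) left right) (λ v → indicator (v ≟ᵛ top-row)) bottom-row
    ∑-configs = begin
      foldr _+_ 0# (map (weightOf w) (filter (obeys? b) (allConfigs n L)))
        ≡⟨ ∑-definition (filter (obeys? b) (allConfigs n L)) (weightOf w) ⟨
      ∑ (filter (obeys? b) (allConfigs n L)) (weightOf w)
        ≈⟨ ∑-filter (obeys? b) (allConfigs n L) (weightOf w) ⟩
      ∑ (allConfigs n L) (λ κ → indicator (obeys? b κ) * weightOf w κ)
        ≈⟨ ∑-cartesianProductWith _,_ H (allVecs (strings L) (suc n)) _ ⟩
      ∑ H (λ hs → ∑ (allVecs (strings L) (suc n)) (λ vs →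
        indicator (obeys? b (hs , vs)) * weightOf w (hs , vs)))
        ≈⟨ ∑-cong H (λ hs → ∑-cartesianProductWith _∷_ (strings L) V _) ⟩
      ∑ H (λ hs → ∑ (strings L) (λ v → ∑ V (λ vs →
        indicator (obeys? b (hs , v ∷ vs)) * weightOf w (hs , v ∷ vs))))
        ≈⟨ ∑-cong H (λ hs → ∑-cong (strings L) (λ v →
             trans (∑-cong V (obeys-indicator hs v)) (sym (*-∑ _ V _)))) ⟩
      ∑ H (λ hs → ∑ (strings L) (λ v → indicator (v ≟ᵛ bottom-row) * ∑ V (S hs v)))
        ≈⟨ ∑-cong H (λ hs → ∑-δᵛ bottom-row _) ⟩
      ∑ H (λ hs → ∑ V (S hs bottom-row))
        ≈⟨ ∑-stack left right top-row w bottom-row ⟩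
      apply (λ i → transfer (w i) left right) (λ v → indicator (v ≟ᵛ top-row)) bottom-row  ∎
      where
      H = allVecs (strings (suc L)) n
      V = allVecs (strings L) n
      S : Vec (Vec State (suc L)) n → Vec State L → Vec (Vec State L) n → Carrier
      S = stack left right top-row w

-- The Yang-Baxter equation as a polynomial identity

-- The numerators of W_{y/x} over the common denominator dd′, as polynomials in
-- q, x and y.
module Numerator where
  q x y d d′ : Expr ℤ 3
  q  = Ι 0F
  x  = Ι 1F
  y  = Ι 2F
  d  = x ⊖ q ↑ 2 ⊗ y
  d′ = x ⊖ q ↑ 3 ⊗ y

  numerator : (i j k ℓ : State) → Expr ℤ 3
  numerator 0F 0F 0F 0F = d ⊗ d′
  numerator 2F 2F 2F 2F = d ⊗ d′
  numerator 1F 0F 1F 0F = q ↑ 2 ⊗ (x ⊖ y) ⊗ d′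
  numerator 2F 1F 2F 1F = q ↑ 2 ⊗ (x ⊖ y) ⊗ d′
  numerator 1F 0F 0F 1F = (𝟙 ⊖ q ↑ 2) ⊗ x ⊗ d′
  numerator 2F 1F 1F 2F = (𝟙 ⊖ q ↑ 2) ⊗ x ⊗ d′
  numerator 0F 1F 1F 0F = (𝟙 ⊖ q ↑ 2) ⊗ y ⊗ d′
  numerator 1F 2F 2F 1F = (𝟙 ⊖ q ↑ 2) ⊗ y ⊗ d′
  numerator 0F 1F 0F 1F = (x ⊖ y) ⊗ d′
  numerator 1F 2F 1F 2F = (x ⊖ y) ⊗ d′
  numerator 2F 0F 2F 0F = q ↑ 4 ⊗ (x ⊖ y) ⊗ (x ⊖ q ⊗ y)
  numerator 2F 0F 1F 1F = ⊝ (q ⊗ (𝟙 ⊖ q) ↑ 2 ⊗ (𝟙 ⊕ q) ⊗ x ⊗ (x ⊖ y))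
  numerator 2F 0F 0F 2F = (𝟙 ⊖ q ↑ 2) ⊗ x ⊗ (x ⊕ q ⊗ x ⊖ q ⊗ y ⊖ q ↑ 3 ⊗ y)
  numerator 1F 1F 2F 0F = ⊝ (q ↑ 4 ⊗ (𝟙 ⊕ q) ⊗ (x ⊖ y) ⊗ y)
  numerator 1F 1F 1F 1F = ⊝ (q ⊗ x ↑ 2) ⊕ (𝟙 ⊕ q) ⊗ (𝟙 ⊖ q ↑ 2 ⊕ q ↑ 4) ⊗ x ⊗ y ⊖ q ↑ 4 ⊗ y ↑ 2
  numerator 1F 1F 0F 2F = (𝟙 ⊕ q) ⊗ x ⊗ (x ⊖ y)
  numerator 0F 2F 2F 0F = (𝟙 ⊖ q ↑ 2) ⊗ (x ⊕ q ↑ 2 ⊗ x ⊖ q ↑ 2 ⊗ y ⊖ q ↑ 3 ⊗ y) ⊗ y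
  numerator 0F 2F 1F 1F = q ⊗ (𝟙 ⊖ q) ↑ 2 ⊗ (𝟙 ⊕ q) ⊗ (x ⊖ y) ⊗ y
  numerator 0F 2F 0F 2F = (x ⊖ y) ⊗ (x ⊖ q ⊗ y)
  numerator _  _  _  _ = 𝟘

open Numerator using (numerator)

-- The states of two adjacent rows at the same horizontal position, lower row
-- first.
Pair : Set
Pair = State × State

pairs : List Pair
pairs = cartesianProduct (allFin 3) (allFin 3)

∑ᴱ : ∀ {n} {A : Set} → List A → (A → Expr ℤ n) → Expr ℤ n
∑ᴱ xs f = foldr _⊕_ 𝟘 (map f xs)

-- In the expressions with four variables, Ι 0F and Ι 1F stand for the parameters
-- x and x′ of the rows, Ι 2F for the parameter z of the column, and Ι 3F for q.
-- The first argument is the parameter of the horizontal line.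
weightᴱ : (x y : Expr ℤ 4) → (i j k ℓ : State) → Expr ℤ 4
weightᴱ x y i j k ℓ = substitute (Ι 3F ∷ x ∷ y ∷ []) (numerator i j k ℓ)

-- Two vertices on top of each other: bottom state a, top state b, row parameter x
-- below x′.
vertex²ᴱ : (x x′ : Expr ℤ 4) → (a b : State) → (p p′ : Pair) → Expr ℤ 4
vertex²ᴱ x x′ a b (ℓ , ℓ′) (r , r′) = ∑ᴱ (allFin 3) λ s →
  weightᴱ x (Ι 2F) a ℓ s r ⊗ weightᴱ x′ (Ι 2F) s ℓ′ b r′

-- The crossing of two rows, which exchanges their parameters: the numerator of
-- W_{x′/x} with the outgoing states in reversed order.
crossᴱ : (x x′ : Expr ℤ 4) → (p p′ : Pair) → Expr ℤ 4
crossᴱ x x′ (ℓ , ℓ′) (r , r′) = weightᴱ x x′ ℓ ℓ′ r′ r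

-- The two sides of the Yang-Baxter equation: the crossing to the left of the
-- column with x below x′, and to the right of the column with x′ below x.
before after : (a b : State) (p p′ : Pair) → Expr ℤ 4
before a b p p′ = ∑ᴱ pairs λ m → crossᴱ (Ι 0F) (Ι 1F) p m ⊗ vertex²ᴱ (Ι 0F) (Ι 1F) a b m p′
after  a b p p′ = ∑ᴱ pairs λ m → vertex²ᴱ (Ι 1F) (Ι 0F) a b p m ⊗ crossᴱ (Ι 0F) (Ι 1F) m p′

every : (State → Bool) → Bool
every P = P 0F ∧ P 1F ∧ P 2F

every-sound : ∀ P → every P ≡ true → ∀ s → P s ≡ true
every-sound P t 0F = ∧-conicalˡ (P 0F) _ t
every-sound P t 1F = ∧-conicalˡ (P 1F) _ (∧-conicalʳ (P 0F) _ t)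
every-sound P t 2F = ∧-conicalʳ (P 1F) _ (∧-conicalʳ (P 0F) _ t)

opaque
  -- Opaque, so that conversion checking does not attempt to normalise polynomials
  -- that depend on variable states.
  balanced : (a b ℓ ℓ′ r r′ : State) → Bool
  balanced a b ℓ ℓ′ r r′ = identical (before a b (ℓ , ℓ′) (r , r′))
                                     (after a b (ℓ , ℓ′) (r , r′))

opaque
  unfolding balanced

  balanced-identical : ∀ {a b ℓ ℓ′ r r′} → balanced a b ℓ ℓ′ r r′ ≡ true →
    identical (before a b (ℓ , ℓ′) (r , r′)) (after a b (ℓ , ℓ′) (r , r′)) ≡ true
  balanced-identical p = p

  -- The identities for all 3⁶ boundary states, verified by evaluation.
  yang-baxter-check :
    (every λ a → every λ b → every λ ℓ → every λ ℓ′ → every λ r → every λ r′ →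
       balanced a b ℓ ℓ′ r r′) ≡ true
  yang-baxter-check = ≡.refl

yang-baxterᴱ : ∀ a b p p′ → identical (before a b p p′) (after a b p p′) ≡ true
yang-baxterᴱ a b (ℓ , ℓ′) (r , r′) =
  balanced-identical
  (every-sound (λ r′ → balanced a b ℓ ℓ′ r r′)
  (every-sound (λ r → every λ r′ → balanced a b ℓ ℓ′ r r′)
  (every-sound (λ ℓ′ → every λ r → every λ r′ → balanced a b ℓ ℓ′ r r′)
  (every-sound (λ ℓ → every λ ℓ′ → every λ r → every λ r′ → balanced a b ℓ ℓ′ r r′)
  (every-sound (λ b → every λ ℓ → every λ ℓ′ → every λ r → every λ r′ → balanced a b ℓ ℓ′ r r′)
  (every-sound (λ a → every λ b → every λ ℓ → every λ ℓ′ → every λ r → every λ r′ →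
    balanced a b ℓ ℓ′ r r′)
  yang-baxter-check a) b) ℓ) ℓ′) r) r′)

-- Two adjacent rows

module Rows {c ℓ} (R : CommutativeRing c ℓ) where
  open CommutativeRing R hiding (zero)
  open Evaluation R
  open Sums R
  open Lattice R
  open SetoidReasoning setoid
  private variable
    A B : Set

  ∑-*-∑ : ∀ (xs : List A) (ys : List B) (f : A → Carrier) (g : B → Carrier) →
          ∑ xs f * ∑ ys g ≈ ∑ (cartesianProduct xs ys) (λ p → f (proj₁ p) * g (proj₂ p))
  ∑-*-∑ xs ys f g = begin
    ∑ xs f * ∑ ys g                                 ≈⟨ ∑-* xs f _ ⟩
    ∑ xs (λ x → f x * ∑ ys g)                       ≈⟨ ∑-cong xs (λ x → *-∑ (f x) ys g) ⟩
    ∑ xs (λ x → ∑ ys (λ y → f x * g y))             ≈⟨ ∑-cartesianProductWith _,_ xs ys _ ⟨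
    ∑ (cartesianProduct xs ys) (λ p → f (proj₁ p) * g (proj₂ p))  ∎

  -- Associativity of the matrix product.
  ∑-assoc : ∀ (xs : List A) (ys : List B)
            (f : A → Carrier) (g : A → B → Carrier) (h : B → Carrier) →
            ∑ xs (λ x → f x * ∑ ys (λ y → g x y * h y)) ≈
            ∑ ys (λ y → ∑ xs (λ x → f x * g x y) * h y)
  ∑-assoc xs ys f g h = begin
    ∑ xs (λ x → f x * ∑ ys (λ y → g x y * h y))     ≈⟨ ∑-cong xs (λ x → *-∑ (f x) ys _) ⟩
    ∑ xs (λ x → ∑ ys (λ y → f x * (g x y * h y)))   ≈⟨ ∑-swap xs ys _ ⟩
    ∑ ys (λ y → ∑ xs (λ x → f x * (g x y * h y)))   ≈⟨ ∑-cong ys (λ y → ∑-cong xs (λ x → *-assoc _ _ _)) ⟨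
    ∑ ys (λ y → ∑ xs (λ x → f x * g x y * h y))     ≈⟨ ∑-cong ys (λ y → ∑-* xs _ (h y)) ⟨
    ∑ ys (λ y → ∑ xs (λ x → f x * g x y) * h y)     ∎

  line-cong : ∀ {L} {w w′ : Fin L → Weight} → (∀ n i j k ℓ → w n i j k ℓ ≈ w′ n i j k ℓ) →
              ∀ ℓ r u v → line w ℓ r u v ≈ line w′ ℓ r u v
  line-cong w≈w′ ℓ r []      []      = refl
  line-cong w≈w′ ℓ r (a ∷ u) (b ∷ v) =
    ∑-cong states (λ m → *-cong (w≈w′ zero a ℓ b m) (line-cong (w≈w′ ∘ suc) m r u v))

  transfer-weights : ∀ {L} ℓ r {w w′ : Fin L → Weight} → (∀ n i j k ℓ → w n i j k ℓ ≈ w′ n i j k ℓ) →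
                     ∀ f u → transfer w ℓ r f u ≈ transfer w′ ℓ r f u
  transfer-weights {L} ℓ r w≈w′ f u = ∑-cong (strings L) (λ v → *-congʳ (line-cong w≈w′ ℓ r u v))

  transfer-cong : ∀ {L} (w : Fin L → Weight) ℓ r {f g : Vec State L → Carrier} →
                  (∀ v → f v ≈ g v) → ∀ u → transfer w ℓ r f u ≈ transfer w ℓ r g u
  transfer-cong {L} w ℓ r f≈g u = ∑-cong (strings L) (λ v → *-congˡ (f≈g v))

  δ² : Pair → Pair → Carrier
  δ² (a , b) (c , d) = δ a c * δ b d

  ∑-δ² : ∀ p (f : Pair → Carrier) → ∑ pairs (λ m → δ² m p * f m) ≈ f p
  ∑-δ² (a , b) f = begin
    ∑ pairs (λ m → δ² m (a , b) * f m)
      ≈⟨ ∑-cartesianProductWith _,_ states states _ ⟩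
    ∑ states (λ s → ∑ states (λ t → δ s a * δ t b * f (s , t)))
      ≈⟨ ∑-cong states (λ s → trans (∑-cong states (λ t → *-assoc _ _ _))
                                    (sym (*-∑ (δ s a) states _))) ⟩
    ∑ states (λ s → δ s a * ∑ states (λ t → δ t b * f (s , t)))
      ≈⟨ ∑-δ a _ ⟩
    ∑ states (λ t → δ t b * f (a , t))
      ≈⟨ ∑-δ b _ ⟩
    f (a , b)  ∎

  δ²-sym : ∀ p m → δ² p m ≈ δ² m p
  δ²-sym (a , b) (c , d) = reflexive (≡.cong₂ _*_
    (indicator-⇔ (a Fin.≟ c) (c Fin.≟ a) ≡.sym ≡.sym) (indicator-⇔ (b Fin.≟ d) (d Fin.≟ b) ≡.sym ≡.sym))

  -- Two vertices on top of each other in one column, w below w′, summed over the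
  -- edge between them.
  vertex² : (w w′ : Weight) (a b : State) (p p′ : Pair) → Carrier
  vertex² w w′ a b (ℓ , ℓ′) (r , r′) = ∑ states λ s → w a ℓ s r * w′ s ℓ′ b r′

  -- Two rows, w below w′, as a product over the columns.
  line² : ∀ {L} → (w w′ : Fin L → Weight) (p p′ : Pair) (u v : Vec State L) → Carrier
  line² {zero}  w w′ p p′ []      []      = δ² p p′
  line² {suc L} w w′ p p′ (a ∷ u) (b ∷ v) = ∑ pairs λ m →
    vertex² (w zero) (w′ zero) a b p m * line² (w ∘ suc) (w′ ∘ suc) m p′ u v

  -- A product of two row operators can be computed column by column.
  line²-line : ∀ {L} (w w′ : Fin L → Weight) ℓ ℓ′ r r′ u v →
    ∑ (strings L) (λ t → line w ℓ r u t * line w′ ℓ′ r′ t v) ≈ line² w w′ (ℓ , ℓ′) (r , r′) u v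
  line²-line {zero}  w w′ ℓ ℓ′ r r′ []      []      = ∑-singleton [] _
  line²-line {suc L} w w′ ℓ ℓ′ r r′ (a ∷ u) (b ∷ v) = begin
    ∑ (strings (suc L)) (λ t → line w ℓ r (a ∷ u) t * line w′ ℓ′ r′ t (b ∷ v))
      ≈⟨ ∑-strings L _ ⟩
    ∑ states (λ s → ∑ (strings L) (λ t → line w ℓ r (a ∷ u) (s ∷ t) * line w′ ℓ′ r′ (s ∷ t) (b ∷ v)))
      ≈⟨ ∑-cong states (λ s → ∑-cong (strings L) (λ t → ∑-*-∑ states states _ _)) ⟩
    ∑ states (λ s → ∑ (strings L) (λ t → ∑ pairs (λ m →
      w zero a ℓ s (proj₁ m) * line (w ∘ suc) (proj₁ m) r u t *
      (w′ zero s ℓ′ b (proj₂ m) * line (w′ ∘ suc) (proj₂ m) r′ t v))))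
      ≈⟨ ∑-cong states (λ s → ∑-swap (strings L) pairs _) ⟩
    ∑ states (λ s → ∑ pairs (λ m → ∑ (strings L) (λ t →
      w zero a ℓ s (proj₁ m) * line (w ∘ suc) (proj₁ m) r u t *
      (w′ zero s ℓ′ b (proj₂ m) * line (w′ ∘ suc) (proj₂ m) r′ t v))))
      ≈⟨ ∑-swap states pairs _ ⟩
    ∑ pairs (λ m → ∑ states (λ s → ∑ (strings L) (λ t →
      w zero a ℓ s (proj₁ m) * line (w ∘ suc) (proj₁ m) r u t *
      (w′ zero s ℓ′ b (proj₂ m) * line (w′ ∘ suc) (proj₂ m) r′ t v))))
      ≈⟨ ∑-cong pairs (λ m → ∑-cong states (λ s → ∑-cong (strings L) (λ t →
           solve 4 (λ x y x′ y′ → x ⊗ y ⊗ (x′ ⊗ y′) ⊜ x ⊗ x′ ⊗ (y ⊗ y′)) refl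
             (w zero a ℓ s (proj₁ m)) (line (w ∘ suc) (proj₁ m) r u t)
             (w′ zero s ℓ′ b (proj₂ m)) (line (w′ ∘ suc) (proj₂ m) r′ t v)))) ⟩
    ∑ pairs (λ m → ∑ states (λ s → ∑ (strings L) (λ t →
      w zero a ℓ s (proj₁ m) * w′ zero s ℓ′ b (proj₂ m) *
      (line (w ∘ suc) (proj₁ m) r u t * line (w′ ∘ suc) (proj₂ m) r′ t v))))
      ≈⟨ ∑-cong pairs (λ m → trans (∑-cong states (λ s → sym (*-∑ _ (strings L) _)))
                                   (sym (∑-* states _ _))) ⟩
    ∑ pairs (λ m → vertex² (w zero) (w′ zero) a b (ℓ , ℓ′) m *
      ∑ (strings L) (λ t → line (w ∘ suc) (proj₁ m) r u t * line (w′ ∘ suc) (proj₂ m) r′ t v))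
      ≈⟨ ∑-cong pairs (λ m → *-congˡ (line²-line (w ∘ suc) (w′ ∘ suc) (proj₁ m) (proj₂ m) r r′ u v)) ⟩
    line² w w′ (ℓ , ℓ′) (r , r′) (a ∷ u) (b ∷ v)  ∎

  -- Transfer operators commute if exchanging the two rows does not change the
  -- corresponding entry of the two-row operator.
  transfer-commute : ∀ {L} (w w′ : Fin L → Weight) ℓ r →
    (∀ u v → line² w w′ (ℓ , ℓ) (r , r) u v ≈ line² w′ w (ℓ , ℓ) (r , r) u v) →
    ∀ f u → transfer w ℓ r (transfer w′ ℓ r f) u ≈ transfer w′ ℓ r (transfer w ℓ r f) u
  transfer-commute {L} w w′ ℓ r swap f u = begin
    transfer w ℓ r (transfer w′ ℓ r f) u                        ≈⟨ transfer-∘ w w′ ⟩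
    ∑ (strings L) (λ v → line² w w′ (ℓ , ℓ) (r , r) u v * f v)  ≈⟨ swapped ⟩
    ∑ (strings L) (λ v → line² w′ w (ℓ , ℓ) (r , r) u v * f v)  ≈⟨ transfer-∘ w′ w ⟨
    transfer w′ ℓ r (transfer w ℓ r f) u                        ∎
    where
    swapped = ∑-cong (strings L) (λ v → *-congʳ (swap u v))
    transfer-∘ : ∀ (w w′ : Fin L → Weight) → transfer w ℓ r (transfer w′ ℓ r f) u ≈
                 ∑ (strings L) (λ v → line² w w′ (ℓ , ℓ) (r , r) u v * f v)
    transfer-∘ w w′ = trans
      (∑-assoc (strings L) (strings L) (line w ℓ r u) (line w′ ℓ r) f)
      (∑-cong (strings L) (λ v → *-congʳ (line²-line w w′ ℓ ℓ r r u v)))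

  -- The Yang-Baxter equation for the crossing weights C.
  Intertwines : (Pair → Pair → Carrier) → (w w′ : Weight) → Set ℓ
  Intertwines C w w′ = ∀ a b p p′ →
    ∑ pairs (λ m → C p m * vertex² w w′ a b m p′) ≈ ∑ pairs (λ m → vertex² w′ w a b p m * C m p′)

  -- The crossing moves from the left end of two rows to the right end.
  train : ∀ {L} (C : Pair → Pair → Carrier) (w w′ : Fin L → Weight) →
          (∀ i → Intertwines C (w i) (w′ i)) → ∀ p p′ u v →
          ∑ pairs (λ m → C p m * line² w w′ m p′ u v) ≈ ∑ pairs (λ m → line² w′ w p m u v * C m p′)
  train {zero} C w w′ yb p p′ [] [] = begin
    ∑ pairs (λ m → C p m * δ² m p′)  ≈⟨ ∑-cong pairs (λ m → *-comm _ _) ⟩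
    ∑ pairs (λ m → δ² m p′ * C p m)  ≈⟨ ∑-δ² p′ (C p) ⟩
    C p p′                           ≈⟨ ∑-δ² p (λ m → C m p′) ⟨
    ∑ pairs (λ m → δ² m p * C m p′)  ≈⟨ ∑-cong pairs (λ m → *-congʳ (δ²-sym m p)) ⟩
    ∑ pairs (λ m → δ² p m * C m p′)  ∎
  train {suc L} C w w′ yb p p′ (a ∷ u) (b ∷ v) = begin
    ∑ pairs (λ m → C p m * ∑ pairs (λ n → vertex² (w zero) (w′ zero) a b m n * tail n))
      ≈⟨ ∑-assoc pairs pairs (C p) _ tail ⟩
    ∑ pairs (λ n → ∑ pairs (λ m → C p m * vertex² (w zero) (w′ zero) a b m n) * tail n)
      ≈⟨ ∑-cong pairs (λ n → *-congʳ (yb zero a b p n)) ⟩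
    ∑ pairs (λ n → ∑ pairs (λ m → vertex² (w′ zero) (w zero) a b p m * C m n) * tail n)
      ≈⟨ ∑-assoc pairs pairs (vertex² (w′ zero) (w zero) a b p) C tail ⟨
    ∑ pairs (λ m → vertex² (w′ zero) (w zero) a b p m * ∑ pairs (λ n → C m n * tail n))
      ≈⟨ ∑-cong pairs (λ m → *-congˡ (train C (w ∘ suc) (w′ ∘ suc) (yb ∘ suc) m p′ u v)) ⟩
    ∑ pairs (λ m → vertex² (w′ zero) (w zero) a b p m *
      ∑ pairs (λ n → line² (w′ ∘ suc) (w ∘ suc) m n u v * C n p′))
      ≈⟨ ∑-assoc pairs pairs (vertex² (w′ zero) (w zero) a b p) _ (λ n → C n p′) ⟩
    ∑ pairs (λ n → line² w′ w p n (a ∷ u) (b ∷ v) * C n p′)  ∎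
    where
    tail : Pair → Carrier
    tail n = line² (w ∘ suc) (w′ ∘ suc) n p′ u v

  -- A crossing with the pair of states p on either side is d times the identity.
  Rigid : Carrier → (Pair → Pair → Carrier) → Pair → Set ℓ
  Rigid d C p = (∀ m → C p m ≈ d * δ² m p) × (∀ m → C m p ≈ d * δ² m p)

  line²-swap : ∀ {L} (C : Pair → Pair → Carrier) (w w′ : Fin L → Weight) →
               (∀ i → Intertwines C (w i) (w′ i)) →
               ∀ d p p′ → Rigid d C p → Rigid d C p′ →
               ∀ u v → d * line² w w′ p p′ u v ≈ d * line² w′ w p p′ u v
  line²-swap C w w′ yb d p p′ (rigid , _) (_ , rigid′) u v = begin
    d * line² w w′ p p′ u v
      ≈⟨ pick p (λ m → line² w w′ m p′ u v) ⟨
    ∑ pairs (λ m → d * δ² m p * line² w w′ m p′ u v)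
      ≈⟨ ∑-cong pairs (λ m → *-congʳ (rigid m)) ⟨
    ∑ pairs (λ m → C p m * line² w w′ m p′ u v)
      ≈⟨ train C w w′ yb p p′ u v ⟩
    ∑ pairs (λ m → line² w′ w p m u v * C m p′)
      ≈⟨ ∑-cong pairs (λ m → trans (*-comm _ _) (*-congʳ (rigid′ m))) ⟩
    ∑ pairs (λ m → d * δ² m p′ * line² w′ w p m u v)
      ≈⟨ pick p′ (λ m → line² w′ w p m u v) ⟩
    d * line² w′ w p p′ u v  ∎
    where
    pick : ∀ p (f : Pair → Carrier) → ∑ pairs (λ m → d * δ² m p * f m) ≈ d * f p
    pick p f = trans (∑-cong pairs (λ m → *-assoc _ _ _))
                     (trans (sym (*-∑ d pairs _)) (*-congˡ (∑-δ² p f)))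

  -- The weight W_{y/x} multiplied by (x - q²y)(x - q³y).
  numeratorWeight : (q x y : Carrier) → Weight
  numeratorWeight q x y i j k ℓ = ⟦ numerator i j k ℓ ⟧ (q ∷ x ∷ y ∷ [])

  -- The numerator of W_{x′/x}, as a matrix from incoming to outgoing pairs.
  cross : (q x x′ : Carrier) → Pair → Pair → Carrier
  cross q x x′ (ℓ , ℓ′) (r , r′) = numeratorWeight q x x′ ℓ ℓ′ r′ r

  opaque
    unfolding ∑

    ⟦∑⟧ : ∀ {n} (xs : List A) (f : A → Expr ℤ n) ρ → ⟦ ∑ᴱ xs f ⟧ ρ ≡ ∑ xs (λ x → ⟦ f x ⟧ ρ)
    ⟦∑⟧ []       f ρ = ≡.refl
    ⟦∑⟧ (x ∷ xs) f ρ = ≡.cong (λ a → ⟦ f x ⟧ ρ + a) (⟦∑⟧ xs f ρ)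

  module _ (q x x′ z : Carrier) where
    private
      ρ : Vec Carrier 4
      ρ = x ∷ x′ ∷ z ∷ q ∷ []

    ⟦weight⟧ : ∀ a b i j k ℓ →
      ⟦ weightᴱ a b i j k ℓ ⟧ ρ ≡ numeratorWeight q (⟦ a ⟧ ρ) (⟦ b ⟧ ρ) i j k ℓ
    ⟦weight⟧ a b i j k ℓ = substitute-correct (Ι 3F ∷ a ∷ b ∷ []) (numerator i j k ℓ) ρ

    ⟦vertex²⟧ : ∀ x x′ a b p p′ → ⟦ vertex²ᴱ x x′ a b p p′ ⟧ ρ ≈
      vertex² (numeratorWeight q (⟦ x ⟧ ρ) z) (numeratorWeight q (⟦ x′ ⟧ ρ) z) a b p p′
    ⟦vertex²⟧ x x′ a b (ℓ , ℓ′) (r , r′) = trans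
      (reflexive (⟦∑⟧ states (λ s → weightᴱ x (Ι 2F) a ℓ s r ⊗ weightᴱ x′ (Ι 2F) s ℓ′ b r′) ρ))
      (∑-cong states (λ s → reflexive (≡.cong₂ _*_
        (⟦weight⟧ x (Ι 2F) a ℓ s r) (⟦weight⟧ x′ (Ι 2F) s ℓ′ b r′))))

    yang-baxter : Intertwines (cross q x x′) (numeratorWeight q x z) (numeratorWeight q x′ z)
    yang-baxter a b p p′ = begin
      ∑ pairs (λ m → cross q x x′ p m * vertex² w w′ a b m p′)
        ≈⟨ ∑-cong pairs (λ m → *-cong
             (reflexive (⟦weight⟧ (Ι 0F) (Ι 1F) (proj₁ p) (proj₂ p) (proj₂ m) (proj₁ m)))
             (⟦vertex²⟧ (Ι 0F) (Ι 1F) a b m p′)) ⟨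
      ∑ pairs (λ m → ⟦ crossᴱ (Ι 0F) (Ι 1F) p m ⊗ vertex²ᴱ (Ι 0F) (Ι 1F) a b m p′ ⟧ ρ)
        ≡⟨ ⟦∑⟧ pairs (λ m → crossᴱ (Ι 0F) (Ι 1F) p m ⊗ vertex²ᴱ (Ι 0F) (Ι 1F) a b m p′) ρ ⟨
      ⟦ before a b p p′ ⟧ ρ
        ≈⟨ identical-correct (before a b p p′) (after a b p p′) (yang-baxterᴱ a b p p′) ρ ⟩
      ⟦ after a b p p′ ⟧ ρ
        ≡⟨ ⟦∑⟧ pairs (λ m → vertex²ᴱ (Ι 1F) (Ι 0F) a b p m ⊗ crossᴱ (Ι 0F) (Ι 1F) m p′) ρ ⟩
      ∑ pairs (λ m → ⟦ vertex²ᴱ (Ι 1F) (Ι 0F) a b p m ⊗ crossᴱ (Ι 0F) (Ι 1F) m p′ ⟧ ρ)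
        ≈⟨ ∑-cong pairs (λ m → *-cong
             (⟦vertex²⟧ (Ι 1F) (Ι 0F) a b p m)
             (reflexive (⟦weight⟧ (Ι 0F) (Ι 1F) (proj₁ m) (proj₂ m) (proj₂ p′) (proj₁ p′)))) ⟩
      ∑ pairs (λ m → vertex² w′ w a b p m * cross q x x′ m p′)  ∎
      where
      w w′ : Weight
      w  = numeratorWeight q x z
      w′ = numeratorWeight q x′ z

  infixl 7 _⋆_
  -- All weights of a vertex multiplied by a common factor, which will be the
  -- reciprocal of their denominator.
  _⋆_ : Weight → Carrier → Weight
  (w ⋆ a) i j k ℓ = w i j k ℓ * a

  vertex²-⋆ : ∀ w w′ α β a b p p′ →
              vertex² (w ⋆ α) (w′ ⋆ β) a b p p′ ≈ α * β * vertex² w w′ a b p p′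
  vertex²-⋆ w w′ α β a b (ℓ , ℓ′) (r , r′) = trans
    (∑-cong states (λ s → solve 4 (λ x α y β → x ⊗ α ⊗ (y ⊗ β) ⊜ α ⊗ β ⊗ (x ⊗ y)) refl
      (w a ℓ s r) α (w′ s ℓ′ b r′) β))
    (sym (*-∑ (α * β) states _))

  intertwines-⋆ : ∀ C w w′ α β → Intertwines C w w′ → Intertwines C (w ⋆ α) (w′ ⋆ β)
  intertwines-⋆ C w w′ α β yb a b p p′ = begin
    ∑ pairs (λ m → C p m * vertex² (w ⋆ α) (w′ ⋆ β) a b m p′)
      ≈⟨ ∑-cong pairs (λ m → trans (*-congˡ (vertex²-⋆ w w′ α β a b m p′))
           (solve 3 (λ x y z → x ⊗ (y ⊗ z) ⊜ y ⊗ (x ⊗ z)) refl _ _ _)) ⟩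
    ∑ pairs (λ m → α * β * (C p m * vertex² w w′ a b m p′))
      ≈⟨ *-∑ (α * β) pairs _ ⟨
    α * β * ∑ pairs (λ m → C p m * vertex² w w′ a b m p′)
      ≈⟨ *-congˡ (yb a b p p′) ⟩
    α * β * ∑ pairs (λ m → vertex² w′ w a b p m * C m p′)
      ≈⟨ *-∑ (α * β) pairs _ ⟩
    ∑ pairs (λ m → α * β * (vertex² w′ w a b p m * C m p′))
      ≈⟨ ∑-cong pairs (λ m → trans (sym (*-assoc _ _ _)) (*-congʳ
           (trans (*-congʳ (*-comm α β)) (sym (vertex²-⋆ w′ w β α a b p m))))) ⟩
    ∑ pairs (λ m → vertex² (w′ ⋆ β) (w ⋆ α) a b p m * C m p′)  ∎

  module _ (q x x′ : Carrier) where
    -- (x - q²x′)(x - q³x′).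
    denominator : Carrier
    denominator = ⟦ (Ι 1F ⊖ Ι 0F ↑ 2 ⊗ Ι 2F) ⊗ (Ι 1F ⊖ Ι 0F ↑ 3 ⊗ Ι 2F) ⟧ (q ∷ x ∷ x′ ∷ [])

    rigid-on : denominator ≈ denominator * (1# * 1#)
    rigid-on = sym (trans (*-congˡ (*-identityʳ 1#)) (*-identityʳ denominator))

    rigid-offˡ : ∀ a → 0# ≈ denominator * (0# * a)
    rigid-offˡ a = sym (trans (*-congˡ (zeroˡ a)) (zeroʳ denominator))

    rigid-offʳ : ∀ a → 0# ≈ denominator * (a * 0#)
    rigid-offʳ a = sym (trans (*-congˡ (zeroʳ a)) (zeroʳ denominator))

    cross-rigid₀ : Rigid denominator (cross q x x′) (0F , 0F)
    cross-rigid₀ =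
        (λ { (0F , 0F) → rigid-on     ; (0F , 1F) → rigid-offʳ _ ; (0F , 2F) → rigid-offʳ _
           ; (1F , 0F) → rigid-offˡ _ ; (1F , 1F) → rigid-offˡ _ ; (1F , 2F) → rigid-offˡ _
           ; (2F , 0F) → rigid-offˡ _ ; (2F , 1F) → rigid-offˡ _ ; (2F , 2F) → rigid-offˡ _ })
      , (λ { (0F , 0F) → rigid-on     ; (0F , 1F) → rigid-offʳ _ ; (0F , 2F) → rigid-offʳ _
           ; (1F , 0F) → rigid-offˡ _ ; (1F , 1F) → rigid-offˡ _ ; (1F , 2F) → rigid-offˡ _
           ; (2F , 0F) → rigid-offˡ _ ; (2F , 1F) → rigid-offˡ _ ; (2F , 2F) → rigid-offˡ _ })

    cross-rigid₂ : Rigid denominator (cross q x x′) (2F , 2F)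
    cross-rigid₂ =
        (λ { (0F , 0F) → rigid-offˡ _ ; (0F , 1F) → rigid-offˡ _ ; (0F , 2F) → rigid-offˡ _
           ; (1F , 0F) → rigid-offˡ _ ; (1F , 1F) → rigid-offˡ _ ; (1F , 2F) → rigid-offˡ _
           ; (2F , 0F) → rigid-offʳ _ ; (2F , 1F) → rigid-offʳ _ ; (2F , 2F) → rigid-on     })
      , (λ { (0F , 0F) → rigid-offˡ _ ; (0F , 1F) → rigid-offˡ _ ; (0F , 2F) → rigid-offˡ _
           ; (1F , 0F) → rigid-offˡ _ ; (1F , 1F) → rigid-offˡ _ ; (1F , 2F) → rigid-offˡ _
           ; (2F , 0F) → rigid-offʳ _ ; (2F , 1F) → rigid-offʳ _ ; (2F , 2F) → rigid-on     })

-- Truncated polynomials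

-- The ring R[t]/(t³).
module Jets {c ℓ} (R : CommutativeRing c ℓ) where
  open CommutativeRing R hiding (zero)
  open Evaluation R
  open Rows R
  open Sums R
  open Lattice R

  -- c₀ + c₁ t + c₂ t².
  record Jet : Set c where
    constructor jet
    field c₀ c₁ c₂ : Carrier
  open Jet public

  record _≋_ (a b : Jet) : Set ℓ where
    constructor eq
    field
      eq₀ : c₀ a ≈ c₀ b
      eq₁ : c₁ a ≈ c₁ b
      eq₂ : c₂ a ≈ c₂ b
  open _≋_ public

  _+ʲ_ _*ʲ_ : Jet → Jet → Jet
  jet a₀ a₁ a₂ +ʲ jet b₀ b₁ b₂ = jet (a₀ + b₀) (a₁ + b₁) (a₂ + b₂)
  jet a₀ a₁ a₂ *ʲ jet b₀ b₁ b₂ =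
    jet (a₀ * b₀) (a₀ * b₁ + a₁ * b₀) (a₀ * b₂ + a₁ * b₁ + a₂ * b₀)

  -ʲ_ : Jet → Jet
  -ʲ jet a₀ a₁ a₂ = jet (- a₀) (- a₁) (- a₂)

  constant : Carrier → Jet
  constant a = jet a 0# 0#

  *ʲ-comm : ∀ a b → (a *ʲ b) ≋ (b *ʲ a)
  *ʲ-comm (jet a₀ a₁ a₂) (jet b₀ b₁ b₂) = eq (*-comm a₀ b₀)
    (solve 4 (λ a₀ a₁ b₀ b₁ → a₀ ⊗ b₁ ⊕ a₁ ⊗ b₀ ⊜ b₀ ⊗ a₁ ⊕ b₁ ⊗ a₀) refl a₀ a₁ b₀ b₁)
    (solve 6 (λ a₀ a₁ a₂ b₀ b₁ b₂ →
        a₀ ⊗ b₂ ⊕ a₁ ⊗ b₁ ⊕ a₂ ⊗ b₀ ⊜ b₀ ⊗ a₂ ⊕ b₁ ⊗ a₁ ⊕ b₂ ⊗ a₀)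
      refl a₀ a₁ a₂ b₀ b₁ b₂)

  *ʲ-assoc : ∀ a b d → ((a *ʲ b) *ʲ d) ≋ (a *ʲ (b *ʲ d))
  *ʲ-assoc (jet a₀ a₁ a₂) (jet b₀ b₁ b₂) (jet d₀ d₁ d₂) = eq (*-assoc a₀ b₀ d₀)
    (solve 6 (λ a₀ a₁ b₀ b₁ d₀ d₁ →
        a₀ ⊗ b₀ ⊗ d₁ ⊕ (a₀ ⊗ b₁ ⊕ a₁ ⊗ b₀) ⊗ d₀ ⊜
        a₀ ⊗ (b₀ ⊗ d₁ ⊕ b₁ ⊗ d₀) ⊕ a₁ ⊗ (b₀ ⊗ d₀))
      refl a₀ a₁ b₀ b₁ d₀ d₁)
    (solve 9 (λ a₀ a₁ a₂ b₀ b₁ b₂ d₀ d₁ d₂ →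
        a₀ ⊗ b₀ ⊗ d₂ ⊕ (a₀ ⊗ b₁ ⊕ a₁ ⊗ b₀) ⊗ d₁ ⊕ (a₀ ⊗ b₂ ⊕ a₁ ⊗ b₁ ⊕ a₂ ⊗ b₀) ⊗ d₀ ⊜
        a₀ ⊗ (b₀ ⊗ d₂ ⊕ b₁ ⊗ d₁ ⊕ b₂ ⊗ d₀) ⊕ a₁ ⊗ (b₀ ⊗ d₁ ⊕ b₁ ⊗ d₀) ⊕ a₂ ⊗ (b₀ ⊗ d₀))
      refl a₀ a₁ a₂ b₀ b₁ b₂ d₀ d₁ d₂)

  *ʲ-identityˡ : ∀ a → (constant 1# *ʲ a) ≋ a
  *ʲ-identityˡ (jet a₀ a₁ a₂) = eq (*-identityˡ a₀)
    (solve 2 (λ a₀ a₁ → 𝟙 ⊗ a₁ ⊕ 𝟘 ⊗ a₀ ⊜ a₁) refl a₀ a₁)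
    (solve 3 (λ a₀ a₁ a₂ → 𝟙 ⊗ a₂ ⊕ 𝟘 ⊗ a₁ ⊕ 𝟘 ⊗ a₀ ⊜ a₂) refl a₀ a₁ a₂)

  *ʲ-distribˡ : ∀ a b d → (a *ʲ (b +ʲ d)) ≋ ((a *ʲ b) +ʲ (a *ʲ d))
  *ʲ-distribˡ (jet a₀ a₁ a₂) (jet b₀ b₁ b₂) (jet d₀ d₁ d₂) = eq (distribˡ a₀ b₀ d₀)
    (solve 6 (λ a₀ a₁ b₀ b₁ d₀ d₁ →
        a₀ ⊗ (b₁ ⊕ d₁) ⊕ a₁ ⊗ (b₀ ⊕ d₀) ⊜ (a₀ ⊗ b₁ ⊕ a₁ ⊗ b₀) ⊕ (a₀ ⊗ d₁ ⊕ a₁ ⊗ d₀))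
      refl a₀ a₁ b₀ b₁ d₀ d₁)
    (solve 9 (λ a₀ a₁ a₂ b₀ b₁ b₂ d₀ d₁ d₂ →
        a₀ ⊗ (b₂ ⊕ d₂) ⊕ a₁ ⊗ (b₁ ⊕ d₁) ⊕ a₂ ⊗ (b₀ ⊕ d₀) ⊜
        (a₀ ⊗ b₂ ⊕ a₁ ⊗ b₁ ⊕ a₂ ⊗ b₀) ⊕ (a₀ ⊗ d₂ ⊕ a₁ ⊗ d₁ ⊕ a₂ ⊗ d₀))
      refl a₀ a₁ a₂ b₀ b₁ b₂ d₀ d₁ d₂)

  *ʲ-cong : ∀ {a a′ b b′} → a ≋ a′ → b ≋ b′ → (a *ʲ b) ≋ (a′ *ʲ b′)
  *ʲ-cong (eq p₀ p₁ p₂) (eq r₀ r₁ r₂) = eq (*-cong p₀ r₀)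
    (+-cong (*-cong p₀ r₁) (*-cong p₁ r₀))
    (+-cong (+-cong (*-cong p₀ r₂) (*-cong p₁ r₁)) (*-cong p₂ r₀))

  ≋-trans : ∀ {a b d} → a ≋ b → b ≋ d → a ≋ d
  ≋-trans (eq p₀ p₁ p₂) (eq r₀ r₁ r₂) = eq (trans p₀ r₀) (trans p₁ r₁) (trans p₂ r₂)

  jets : CommutativeRing c ℓ
  jets = record
    { Carrier = Jet
    ; _≈_ = _≋_
    ; _+_ = _+ʲ_
    ; _*_ = _*ʲ_
    ; -_  = -ʲ_
    ; 0#  = constant 0#
    ; 1#  = constant 1#
    ; isCommutativeRing = record
      { isRing = record
        { +-isAbelianGroup = record
          { isGroup = record
            { isMonoid = record
              { isSemigroup = record
                { isMagma = record
                  { isEquivalence = record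
                    { refl  = eq refl refl refl
                    ; sym   = λ (eq p₀ p₁ p₂) → eq (sym p₀) (sym p₁) (sym p₂)
                    ; trans = ≋-trans
                    }
                  ; ∙-cong = λ (eq p₀ p₁ p₂) (eq r₀ r₁ r₂) →
                      eq (+-cong p₀ r₀) (+-cong p₁ r₁) (+-cong p₂ r₂)
                  }
                ; assoc = λ a b d → eq (+-assoc _ _ _) (+-assoc _ _ _) (+-assoc _ _ _)
                }
              ; identity = (λ a → eq (+-identityˡ _) (+-identityˡ _) (+-identityˡ _))
                         , (λ a → eq (+-identityʳ _) (+-identityʳ _) (+-identityʳ _))
              }
            ; inverse = (λ a → eq (-‿inverseˡ _) (-‿inverseˡ _) (-‿inverseˡ _))
                      , (λ a → eq (-‿inverseʳ _) (-‿inverseʳ _) (-‿inverseʳ _))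
            ; ⁻¹-cong = λ (eq p₀ p₁ p₂) → eq (-‿cong p₀) (-‿cong p₁) (-‿cong p₂)
            }
          ; comm = λ a b → eq (+-comm _ _) (+-comm _ _) (+-comm _ _)
          }
        ; *-cong     = *ʲ-cong
        ; *-assoc    = *ʲ-assoc
        ; *-identity = *ʲ-identityˡ , (λ a → ≋-trans (*ʲ-comm a _) (*ʲ-identityˡ a))
        ; distrib    = *ʲ-distribˡ , (λ a b d → ≋-trans (*ʲ-comm (b +ʲ d) a)
            (≋-trans (*ʲ-distribˡ a b d)
              (eq (+-cong (eq₀ (*ʲ-comm a b)) (eq₀ (*ʲ-comm a d)))
                  (+-cong (eq₁ (*ʲ-comm a b)) (eq₁ (*ʲ-comm a d)))
                  (+-cong (eq₂ (*ʲ-comm a b)) (eq₂ (*ʲ-comm a d))))))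
        }
      ; *-comm = *ʲ-comm
      }
    }

  private
    module J = CommutativeRing jets
    module JE = Evaluation jets
    module JS = Sums jets
    module JL = Lattice jets
    module JR = Rows jets
    open Mult semiring using () renaming (_×_ to _·_)
    open Mult J.semiring using () renaming (_×_ to _·ʲ_)
    open Exp′ semiring using (_^_)
    open Exp′ J.semiring using () renaming (_^_ to _^ʲ_)

  c₀-· : ∀ n → c₀ (n ·ʲ J.1#) ≡ n · 1#
  c₀-· zero          = ≡.refl
  c₀-· (suc zero)    = ≡.refl
  c₀-· (suc (suc n)) = ≡.cong (_+ 1#) (c₀-· (suc n))

  c₀-fromℤ : ∀ i → c₀ (JE.fromℤ i) ≡ fromℤ i
  c₀-fromℤ (+ n)    = c₀-· n
  c₀-fromℤ -[1+ n ] = ≡.cong -_ (c₀-· (suc n))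

  c₀-^ : ∀ a n → c₀ (a ^ʲ n) ≡ c₀ a ^ n
  c₀-^ a zero          = ≡.refl
  c₀-^ a (suc zero)    = ≡.refl
  c₀-^ a (suc (suc n)) = ≡.cong (_* c₀ a) (c₀-^ a (suc n))

  -- The constant term is a ring homomorphism, so it commutes with evaluation.
  c₀-⟦⟧ : ∀ {n} (e : Expr ℤ n) ρ → c₀ (JE.⟦ e ⟧ ρ) ≡ ⟦ e ⟧ (Vec.map c₀ ρ)
  c₀-⟦⟧ (Κ x)   ρ = c₀-fromℤ x
  c₀-⟦⟧ (Ι i)   ρ = ≡.sym (Vec.lookup-map i c₀ ρ)
  c₀-⟦⟧ (a ⊕ b) ρ = ≡.cong₂ _+_ (c₀-⟦⟧ a ρ) (c₀-⟦⟧ b ρ)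
  c₀-⟦⟧ (a ⊗ b) ρ = ≡.cong₂ _*_ (c₀-⟦⟧ a ρ) (c₀-⟦⟧ b ρ)
  c₀-⟦⟧ (a ⊛ k) ρ = ≡.trans (c₀-^ (JE.⟦ a ⟧ ρ) k) (≡.cong (_^ k) (c₀-⟦⟧ a ρ))
  c₀-⟦⟧ (⊝ a)   ρ = ≡.cong -_ (c₀-⟦⟧ a ρ)

  opaque
    unfolding Sums.∑

    c₀-∑ : ∀ {A : Set} (xs : List A) f → c₀ (JS.∑ xs f) ≡ ∑ xs (λ x → c₀ (f x))
    c₀-∑ []       f = ≡.refl
    c₀-∑ (x ∷ xs) f = ≡.cong (λ a → c₀ (f x) + a) (c₀-∑ xs f)

  c₀-δ : ∀ s t → c₀ (JS.δ s t) ≡ δ s t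
  c₀-δ s t with does (s Fin.≟ t)
  ... | true  = ≡.refl
  ... | false = ≡.refl

  c₀-line² : ∀ {L} (ŵ ŵ′ : Fin L → JL.Weight) (w w′ : Fin L → Weight) →
             (∀ n i j k ℓ → c₀ (ŵ n i j k ℓ) ≡ w n i j k ℓ) →
             (∀ n i j k ℓ → c₀ (ŵ′ n i j k ℓ) ≡ w′ n i j k ℓ) →
             ∀ p p′ u v → c₀ (JR.line² ŵ ŵ′ p p′ u v) ≈ line² w w′ p p′ u v
  c₀-line² ŵ ŵ′ w w′ e e′ p p′ [] [] =
    reflexive (≡.cong₂ _*_ (c₀-δ (proj₁ p) (proj₁ p′)) (c₀-δ (proj₂ p) (proj₂ p′)))
  c₀-line² ŵ ŵ′ w w′ e e′ p p′ (a ∷ u) (b ∷ v) = trans (reflexive (c₀-∑ pairs _))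
    (∑-cong pairs (λ m → *-cong
      (trans (reflexive (c₀-∑ (JS.states) _)) (∑-cong states (λ s → reflexive (≡.cong₂ _*_
        (e zero a (proj₁ p) s (proj₁ m)) (e′ zero s (proj₂ p) b (proj₂ m))))))
      (c₀-line² (ŵ ∘ suc) (ŵ′ ∘ suc) (w ∘ suc) (w′ ∘ suc) (e ∘ suc) (e′ ∘ suc) m p′ u v)))

-- The identity over a field

module RowSymmetry {k ℓ₁ ℓ₂} (K : HeytingField k ℓ₁ ℓ₂) (q : HeytingField.Carrier K) where
  open HeytingField K hiding (zero)
  open IzerginKorepin K q

  commutativeRing : CommutativeRing k ℓ₁
  commutativeRing = HeytingCommutativeRing.commutativeRing heytingCommutativeRing
  open CommutativeRing commutativeRing using (ring; semiring; *-commutativeMonoid)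
  open RingProperties ring using (-‿distribˡ-*; -0#≈0#; x∙y⁻¹≈ε⇒x≈y)
  open Exp semiring using (_^_)
  open SetoidReasoning setoid
  open Evaluation commutativeRing
  open Sums commutativeRing
  open Lattice commutativeRing
  open Rows commutativeRing
  open Jets commutativeRing
  private
    module J = CommutativeRing jets
    module JE = Evaluation jets
    module JR = Rows jets
    module JL = Lattice jets

  -- The first two coefficients of (c + t)(a + b t + …) are c a and c b + a.  If a were
  -- apart from 0, then c would vanish by the first equation, and hence a by the
  -- second; tightness turns this contradiction into a ≈ 0.
  cancel-leading : ∀ {c a b} → c * a ≈ 0# → c * b + a ≈ 0# → a ≈ 0#
  cancel-leading {c} {a} {b} ca≈0 cb+a≈0 = proj₁ (tight a 0#) λ a#0 →
    let a⁻¹ , _ , aa⁻¹≈1 = #⇒invertible a#0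
        c≈0 : c ≈ 0#
        c≈0 = begin
          c                       ≈⟨ *-identityʳ c ⟨
          c * 1#                  ≈⟨ *-congˡ aa⁻¹≈1 ⟨
          c * ((a - 0#) * a⁻¹)    ≈⟨ solve 3 (λ c a i → c ⊗ ((a ⊖ 𝟘) ⊗ i) ⊜ c ⊗ a ⊗ i) refl c a a⁻¹ ⟩
          c * a * a⁻¹             ≈⟨ *-congʳ ca≈0 ⟩
          0# * a⁻¹                ≈⟨ zeroˡ a⁻¹ ⟩
          0#                      ∎
        a≈0 : a ≈ 0#
        a≈0 = begin
          a                       ≈⟨ +-identityˡ a ⟨
          0# + a                  ≈⟨ +-congʳ (trans (*-congʳ c≈0) (zeroˡ b)) ⟨
          c * b + a               ≈⟨ cb+a≈0 ⟩
          0#                      ∎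
    in proj₂ (tight a 0#) a≈0 a#0

  -- If the first two coefficients of (c + t) f vanish, so does the first
  -- coefficient of f; if all three vanish, so does the second one.
  cancel-linear₀ : ∀ c f → c₀ (jet c 1# 0# J.* f) ≈ 0# → c₁ (jet c 1# 0# J.* f) ≈ 0# → c₀ f ≈ 0#
  cancel-linear₀ c (jet f₀ f₁ f₂) e₀ e₁ =
    cancel-leading e₀ (trans (+-congˡ (sym (*-identityˡ f₀))) e₁)

  cancel-linear₁ : ∀ c f → (jet c 1# 0# J.* f) J.≈ J.0# → c₁ f ≈ 0#
  cancel-linear₁ c f@(jet f₀ f₁ f₂) (eq e₀ e₁ e₂) = cancel-leading
    (trans (sym (trans (+-congˡ (trans (*-congˡ f₀≈0) (zeroʳ 1#))) (+-identityʳ _))) e₁)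
    (trans (solve 4 (λ c f₀ f₁ f₂ → c ⊗ f₂ ⊕ f₁ ⊜ c ⊗ f₂ ⊕ 𝟙 ⊗ f₁ ⊕ 𝟘 ⊗ f₀) refl c f₀ f₁ f₂) e₂)
    where
    f₀≈0 : f₀ ≈ 0#
    f₀≈0 = cancel-linear₀ c f e₀ e₁

  -- Each linear factor costs one order in t, which is why K[t]/(t³) is used.
  cancel-quadratic : ∀ c c′ f g →
    (jet c 1# 0# J.* jet c′ 1# 0# J.* f) J.≈ (jet c 1# 0# J.* jet c′ 1# 0# J.* g) → c₀ f ≈ c₀ g
  cancel-quadratic c c′ f g Df≈Dg = x∙y⁻¹≈ε⇒x≈y (c₀ f) (c₀ g) (cancel-linear₀ c′ h
    (cancel-linear₀ c (B J.* h) (eq₀ ABh≈0) (eq₁ ABh≈0))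
    (cancel-linear₁ c (B J.* h) ABh≈0))
    where
    A B h : Jet
    A = jet c 1# 0#
    B = jet c′ 1# 0#
    h = f J.- g
    ABh≈0 : (A J.* (B J.* h)) J.≈ J.0#
    ABh≈0 = J.trans
      (JE.solve 4 (λ a b f g → a ⊗ (b ⊗ (f ⊖ g)) ⊜ a ⊗ b ⊗ f ⊖ a ⊗ b ⊗ g) J.refl A B f g)
      (J.trans (J.+-congʳ Df≈Dg) (J.-‿inverseʳ (A J.* B J.* g)))

  constant-* : ∀ a b → (constant a J.* constant b) J.≈ constant (a * b)
  constant-* a b = eq refl
    (solve 2 (λ a b → a ⊗ 𝟘 ⊕ 𝟘 ⊗ b ⊜ 𝟘) refl a b)
    (solve 2 (λ a b → a ⊗ 𝟘 ⊕ 𝟘 ⊗ 𝟘 ⊕ 𝟘 ⊗ b ⊜ 𝟘) refl a b)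

  shift-constant : ∀ x {a b} → a J.≈ constant b → (jet x 1# 0# J.- a) J.≈ jet (x - b) 1# 0#
  shift-constant x a≈b = J.trans (J.+-congˡ (J.-‿cong a≈b))
    (eq refl (trans (+-congˡ -0#≈0#) (+-identityʳ 1#)) (-‿inverseʳ 0#))

  -- The lower row has parameter x + t; all other parameters are lifted as
  -- constants.
  module _ (x x′ : Carrier) where
    q̂ x̂ x̂′ : Jet
    q̂  = constant q
    x̂  = jet x 1# 0#
    x̂′ = constant x′

    denominator-jet : JR.denominator q̂ x̂ x̂′ J.≈
      (jet (x - q ^ 2 * x′) 1# 0# J.* jet (x - q ^ 3 * x′) 1# 0#)
    denominator-jet = J.*-cong
      (shift-constant x (J.trans (J.*-congʳ q̂²) (constant-* _ x′)))
      (shift-constant x (J.trans (J.*-congʳ (J.trans (J.*-congˡ q̂²) (constant-* q _)))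
                                 (constant-* _ x′)))
      where
      q̂² : (q̂ J.* (q̂ J.* J.1#)) J.≈ constant (q ^ 2)
      q̂² = J.trans (J.*-congˡ (constant-* q 1#)) (constant-* q _)

    -- The factors α and β stand for the reciprocals of the denominators.  No relation
    -- between them and the weights is needed.
    line²-commute : ∀ {L} (z α β : Fin L → Carrier) →
      let w  = λ i → numeratorWeight q x  (z i) ⋆ α i
          w′ = λ i → numeratorWeight q x′ (z i) ⋆ β i in
      ∀ p p′ → JR.Rigid (JR.denominator q̂ x̂ x̂′) (JR.cross q̂ x̂ x̂′) p →
               JR.Rigid (JR.denominator q̂ x̂ x̂′) (JR.cross q̂ x̂ x̂′) p′ →
      ∀ u v → line² w w′ p p′ u v ≈ line² w′ w p p′ u v
    line²-commute {L} z α β p p′ rigid rigid′ u v = begin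
      line² w w′ p p′ u v              ≈⟨ c₀-line² ŵ ŵ′ w w′ e e′ p p′ u v ⟨
      c₀ (JR.line² ŵ ŵ′ p p′ u v)      ≈⟨ cancel-quadratic _ _ _ _ jets-commute ⟩
      c₀ (JR.line² ŵ′ ŵ p p′ u v)      ≈⟨ c₀-line² ŵ′ ŵ w′ w e′ e p p′ u v ⟩
      line² w′ w p p′ u v              ∎
      where
      w w′ : Fin L → Weight
      w  i = numeratorWeight q x  (z i) ⋆ α i
      w′ i = numeratorWeight q x′ (z i) ⋆ β i
      ŵ ŵ′ : Fin L → JL.Weight
      ŵ  i = JR.numeratorWeight q̂ x̂  (constant (z i)) JR.⋆ constant (α i)
      ŵ′ i = JR.numeratorWeight q̂ x̂′ (constant (z i)) JR.⋆ constant (β i)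
      e : ∀ n i j k ℓ → c₀ (ŵ n i j k ℓ) ≡ w n i j k ℓ
      e n i j k ℓ = ≡.cong (_* α n) (c₀-⟦⟧ (numerator i j k ℓ) (q̂ ∷ x̂ ∷ constant (z n) ∷ []))
      e′ : ∀ n i j k ℓ → c₀ (ŵ′ n i j k ℓ) ≡ w′ n i j k ℓ
      e′ n i j k ℓ = ≡.cong (_* β n) (c₀-⟦⟧ (numerator i j k ℓ) (q̂ ∷ x̂′ ∷ constant (z n) ∷ []))
      jets-commute = J.trans (J.*-congʳ (J.sym denominator-jet)) (J.trans
        (JR.line²-swap (JR.cross q̂ x̂ x̂′) ŵ ŵ′
          (λ i → JR.intertwines-⋆ _ _ _ (constant (α i)) (constant (β i))
            (JR.yang-baxter q̂ x̂ x̂′ (constant (z i))))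
          (JR.denominator q̂ x̂ x̂′) p p′ rigid rigid′ u v)
        (J.*-congʳ denominator-jet))

  inverse-unique : ∀ {a b} (p p′ : a # b) → inverse p ≈ inverse p′
  inverse-unique {a} {b} p p′ with #⇒invertible p | #⇒invertible p′
  ... | i , il , _ | i′ , _ , i′r = begin
    i                    ≈⟨ *-identityʳ i ⟨
    i * 1#               ≈⟨ *-congˡ i′r ⟨
    i * ((a - b) * i′)   ≈⟨ *-assoc i (a - b) i′ ⟨
    i * (a - b) * i′     ≈⟨ *-congʳ il ⟩
    1# * i′              ≈⟨ *-identityˡ i′ ⟩
    i′                   ∎

  -- The reciprocal of (x - q²y)(x - q³y).
  normalisation : ∀ {y x} → Regular y x → Carrier
  normalisation (p , p′) = inverse p * inverse p′

  normalisation-unique : ∀ {y x} (reg reg′ : Regular y x) → normalisation reg ≈ normalisation reg′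
  normalisation-unique (p , p′) (r , r′) = *-cong (inverse-unique p r) (inverse-unique p′ r′)

  module _ (y x : Carrier) (reg : Regular y x) where
    private
      d d′ d⁻¹ d′⁻¹ : Carrier
      d    = x - q ^ 2 * y
      d′   = x - q ^ 3 * y
      d⁻¹  = inverse (proj₁ reg)
      d′⁻¹ = inverse (proj₂ reg)
      dd⁻¹≈1 : d * d⁻¹ ≈ 1#
      dd⁻¹≈1 = proj₂ (proj₂ (#⇒invertible (proj₁ reg)))
      d′d′⁻¹≈1 : d′ * d′⁻¹ ≈ 1#
      d′d′⁻¹≈1 = proj₂ (proj₂ (#⇒invertible (proj₂ reg)))

      nil : 0# ≈ 0# * (d⁻¹ * d′⁻¹)
      nil = sym (zeroˡ _)

      linear : ∀ {n} → n * d⁻¹ ≈ n * d′ * (d⁻¹ * d′⁻¹)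
      linear {n} = begin
        n * d⁻¹                    ≈⟨ *-identityʳ _ ⟨
        n * d⁻¹ * 1#               ≈⟨ *-congˡ d′d′⁻¹≈1 ⟨
        n * d⁻¹ * (d′ * d′⁻¹)      ≈⟨ solve 4 (λ n i d′ i′ → n ⊗ i ⊗ (d′ ⊗ i′) ⊜ n ⊗ d′ ⊗ (i ⊗ i′))
                                        refl n d⁻¹ d′ d′⁻¹ ⟩
        n * d′ * (d⁻¹ * d′⁻¹)      ∎

      unit : 1# ≈ d * d′ * (d⁻¹ * d′⁻¹)
      unit = trans (sym dd⁻¹≈1) linear

      negative : ∀ {n} → - (n * (d⁻¹ * d′⁻¹)) ≈ - n * (d⁻¹ * d′⁻¹)
      negative = -‿distribˡ-* _ _

    -- The numerators are those of the vertex weights: nil where the weight is 0, unit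
    -- where it is 1, linear where it has the denominator x - q²y only, and negative or
    -- refl where it has the full denominator.
    W-numerator : ∀ i j k ℓ →
      W y x reg i j k ℓ ≈ numeratorWeight q x y i j k ℓ * normalisation reg
    W-numerator 0F 0F = λ
      { 0F 0F → unit ; 0F 1F → nil ; 0F 2F → nil
      ; 1F 0F → nil ; 1F 1F → nil ; 1F 2F → nil
      ; 2F 0F → nil ; 2F 1F → nil ; 2F 2F → nil
      }
    W-numerator 0F 1F = λ
      { 0F 0F → nil ; 0F 1F → linear ; 0F 2F → nil
      ; 1F 0F → linear ; 1F 1F → nil ; 1F 2F → nil
      ; 2F 0F → nil ; 2F 1F → nil ; 2F 2F → nil
      }
    W-numerator 0F 2F = λ
      { 0F 0F → nil ; 0F 1F → nil ; 0F 2F → refl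
      ; 1F 0F → nil ; 1F 1F → refl ; 1F 2F → nil
      ; 2F 0F → refl ; 2F 1F → nil ; 2F 2F → nil
      }
    W-numerator 1F 0F = λ
      { 0F 0F → nil ; 0F 1F → linear ; 0F 2F → nil
      ; 1F 0F → linear ; 1F 1F → nil ; 1F 2F → nil
      ; 2F 0F → nil ; 2F 1F → nil ; 2F 2F → nil
      }
    W-numerator 1F 1F = λ
      { 0F 0F → nil ; 0F 1F → nil ; 0F 2F → refl
      ; 1F 0F → nil ; 1F 1F → refl ; 1F 2F → nil
      ; 2F 0F → negative ; 2F 1F → nil ; 2F 2F → nil
      }
    W-numerator 1F 2F = λ
      { 0F 0F → nil ; 0F 1F → nil ; 0F 2F → nil
      ; 1F 0F → nil ; 1F 1F → nil ; 1F 2F → linear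
      ; 2F 0F → nil ; 2F 1F → linear ; 2F 2F → nil
      }
    W-numerator 2F 0F = λ
      { 0F 0F → nil ; 0F 1F → nil ; 0F 2F → refl
      ; 1F 0F → nil ; 1F 1F → negative ; 1F 2F → nil
      ; 2F 0F → refl ; 2F 1F → nil ; 2F 2F → nil
      }
    W-numerator 2F 1F = λ
      { 0F 0F → nil ; 0F 1F → nil ; 0F 2F → nil
      ; 1F 0F → nil ; 1F 1F → nil ; 1F 2F → linear
      ; 2F 0F → nil ; 2F 1F → linear ; 2F 2F → nil
      }
    W-numerator 2F 2F = λ
      { 0F 0F → nil ; 0F 1F → nil ; 0F 2F → nil
      ; 1F 0F → nil ; 1F 1F → nil ; 1F 2F → nil
      ; 2F 0F → nil ; 2F 1F → nil ; 2F 2F → unit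
      }

  module _ {n L : ℕ} (x : Fin n → Carrier) (z : ℕ → Carrier) (reg : AllRegular x z) where
    -- The vertex weights of all rows, as given and as numerator times reciprocal.
    vertexWeight normalisedWeight : Fin n → Fin L → Weight
    vertexWeight r c = W (z (toℕ c)) (x r) (reg r (toℕ c))
    normalisedWeight r c = numeratorWeight q (x r) (z (toℕ c)) ⋆ normalisation (reg r (toℕ c))

  -- The states s for which a crossing with s twice on one side is a multiple of the
  -- identity.
  Corner : State → Set
  Corner s = s ≡ 0F ⊎ s ≡ 2F

  cross-rigid : ∀ x x′ {s} → Corner s →
    JR.Rigid (JR.denominator (q̂ x x′) (x̂ x x′) (x̂′ x x′))
             (JR.cross (q̂ x x′) (x̂ x x′) (x̂′ x x′)) (s , s)
  cross-rigid x x′ (inj₁ ≡.refl) = JR.cross-rigid₀ _ _ _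
  cross-rigid x x′ (inj₂ ≡.refl) = JR.cross-rigid₂ _ _ _

  -- The reciprocals may be given by different proofs of apartness before and after
  -- the permutation; this does not matter, as inverses are unique.
  partitionFunction-symmetric : ∀ {n L} (b : Boundary L) →
    Corner (Boundary.left b) → Corner (Boundary.right b) → Symmetric {n} (partitionFunction b)
  partitionFunction-symmetric {n} {L} b cornerˡ cornerʳ σ x z reg regσ = begin
    partitionFunction b xσ z regσ
      ≈⟨ ∑-configs b (vertexWeight xσ z regσ) ⟩
    apply (λ r → transfer (vertexWeight xσ z regσ r) left right) end bottom-row′
      ≈⟨ apply-cong _ _ (λ r → transfer-cong _ left right)
           (λ r → transfer-weights left right (λ c i j k ℓ → trans
             (W-numerator _ _ (regσ r (toℕ c)) i j k ℓ)
             (*-congˡ (normalisation-unique (regσ r (toℕ c)) (reg (σ ⟨$⟩ʳ r) (toℕ c)))))) end bottom-row′ ⟩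
    apply (A ∘ (σ ⟨$⟩ʳ_)) end bottom-row′
      ≈⟨ apply-permute A (λ r → transfer-cong _ left right) commuting σ end bottom-row′ ⟩
    apply A end bottom-row′
      ≈⟨ apply-cong _ _ (λ r → transfer-cong _ left right)
           (λ r → transfer-weights left right (λ c i j k ℓ →
             W-numerator _ _ (reg r (toℕ c)) i j k ℓ)) end bottom-row′ ⟨
    apply (λ r → transfer (vertexWeight x z reg r) left right) end bottom-row′
      ≈⟨ ∑-configs b (vertexWeight x z reg) ⟨
    partitionFunction b x z reg  ∎
    where
    open Boundary b
    xσ = x ∘ (σ ⟨$⟩ʳ_)
    bottom-row′ = bottom-row b (vertexWeight x z reg)
    end : Vec State L → Carrier
    end v = indicator (v ≟ᵛ top-row b (vertexWeight x z reg))
    w : Fin n → Fin L → Weight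
    w = normalisedWeight x z reg
    A : Fin n → (Vec State L → Carrier) → (Vec State L → Carrier)
    A r = transfer (w r) left right
    commuting : Commuting A
    commuting r s = transfer-commute (w r) (w s) left right
      (line²-commute (x r) (x s) (z ∘ toℕ) _ _ (left , left) (right , right)
        (cross-rigid (x r) (x s) cornerˡ) (cross-rigid (x r) (x s) cornerʳ))

-- Symmetry of F and G

open import Data.Nat.Base using (_≤_; _*_)

theorem1p5p3 : ∀ {k ℓ₁ ℓ₂} (K : HeytingField k ℓ₁ ℓ₂) (q : HeytingField.Carrier K)
    (N M : ℕ) → 1 ≤ N → 1 ≤ M →
    (S : TwoString) → ∣ S ∣ ≡ 2 * N →
    let open IzerginKorepin K q in
    (∀ L → VanishesFrom L S → Symmetric (F {N} L S))
    × (∀ L → N ≤ L → VanishesFrom L S → Symmetric (G {M} N L S))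
theorem1p5p3 K q N M _ _ S _ =
    (λ L _ → partitionFunction-symmetric (boundaryF S L) (inj₂ ≡.refl) (inj₁ ≡.refl))
  , (λ L _ _ → partitionFunction-symmetric (boundaryG N S L) (inj₁ ≡.refl) (inj₁ ≡.refl))
  where open RowSymmetry K q
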